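{- Let $\rho\ge 6$ be an integer having a prime divisor greater than $3$. Then $M(\rho)=4$.
   Context: For a positive integer $\rho$, let $S_\rho=\{n\in\mathbb{Z} : n\ge 0,\ n\neq\rho\}$. For a positive integer $n$, let $k_\rho(n)$ be the least positive integer $m$ such that $n=x_1^2+\cdots+x_m^2$ for some $x_1,\dots,x_m\in S_\rho$, and $k_\rho(n)=\infty$ if no such $m$ exists. Let $I(\rho)=\{n\ge1 : k_\rho(n)=\infty\}$ and $M(\rho)=\max\{k_\rho(n) : n\ge 1,\ n\notin I(\rho)\}$. -}

module Defs where

open import Data.Nat using (ℕ; zero; suc; _+_; _*_; _≤_; _<_; _>_)
open import Data.Vec using (Vec; foldr)
open import Data.Vec.Relation.Unary.All using (All)
open import Data.Product using (Σ; ∃; _×_)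
open import Data.Sum using (_⊎_)
open import Relation.Nullary using (¬_)
open import Relation.Binary.PropositionalEquality using (_≡_; _≢_)
open import Data.Nat.Divisibility using (_∣_)
open import Data.Nat.Primality using (Prime)

sumSq : ∀ {m} → Vec ℕ m → ℕ
sumSq = foldr _ (λ x acc → x * x + acc) 0

RepBy : ℕ → ℕ → ℕ → Set
RepBy ρ m n = Σ (Vec ℕ m) λ xs → All (λ x → x ≢ ρ) xs × sumSq xs ≡ n

kIs : ℕ → ℕ → ℕ → Set
kIs ρ n m = 1 ≤ m × RepBy ρ m n × (∀ j → 1 ≤ j → j < m → ¬ RepBy ρ j n)

Finite-k : ℕ → ℕ → Set
Finite-k ρ n = Σ ℕ λ m → 1 ≤ m × RepBy ρ m n

MaxIs : ℕ → ℕ → Set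
MaxIs ρ M =
  (∀ n → 1 ≤ n → Finite-k ρ n → Σ ℕ λ m → kIs ρ n m × m ≤ M)
  × (Σ ℕ λ n → 1 ≤ n × kIs ρ n M)

{-# OPTIONS --safe #-}
module Submission where

-- Fix a prime p > 3 dividing ρ and write n = |x|² for an integral vector x that is not divisible by p; such an x
-- exists because p² = |z|² for a quaternion z whose real part is prime to p, so that y z or y z̄ is not divisible
-- by p when y is not. If no coordinate of x is ± ρ, we are done; otherwise let x₀ = ± ρ. Reflections in vectors
-- of the shape (0,±1,±1,±1), and words of two of them, map x to integral vectors whenever x satisfies a
-- congruence modulo 3 or 9. If the image fails to avoid ρ, then one of eight linear forms vanishes at x. Doing
-- this for several moves cuts the possible x down to subspaces and finally to lines, class by class modulo 9. On a
-- line x₀ s = s₀ x: if s₀ divides a power of 6, then p divides x, a contradiction; else a representation of |s|²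
-- avoiding s₀ is found, except for |s₀| = 5, |s|² = 79. In the latter case ρ = 5k, n = 79k² with |k| > 1, and the
-- argument is repeated with a prime divisor of k in place of p.
--
-- The classes x ≡ (*,0,0,0) modulo 3 are left by a descent on the last three coordinates, which applies
-- reflections in (0,±1,±1,±1) until these coordinates are no longer all divisible by 3.

open import Defs
open import Data.Nat using (ℕ; _≤_; _>_)
open import Data.Product using (Σ; _×_)
open import Data.Nat.Divisibility using (_∣_)
open import Data.Nat.Primality using (Prime)

open import Data.Bool using (Bool; true; false; if_then_else_; _∨_)
open import Data.Empty using (⊥)
open import Data.Fin using (Fin; toℕ; fromℕ<; splitAt; join)
import Data.Fin.Properties as Fin
open import Data.Integer using (ℤ; NonZero; ≢-nonZero; +_; -[1+_]; ∣_∣; _+_; _*_; _-_; -_; _%ℕ_; _/ℕ_; 0ℤ; 1ℤ; -1ℤ; _≟_)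
open import Data.Integer.DivMod using (a≡a%ℕn+[a/ℕn]*n; n%ℕd<d)
open import Data.Integer.Divisibility.Signed renaming (_∣_ to infix 4 _∣ℤ_; _∣?_ to infix 4 _∣ℤ?_)
import Data.Integer.Properties as ℤ
open import Data.Integer.Tactic.RingSolver using (solve-∀)
open import Data.List using (List; []; _∷_; map; concatMap; _++_)
open import Data.List.Relation.Unary.All as All using (All; []; _∷_)
import Data.List.Relation.Unary.All.Properties as All
open import Data.Maybe as Maybe using (Maybe; just; nothing; is-just; _<∣>_)
open import Data.Nat as ℕ using (zero; suc; z≤n; s≤s)
import Data.Nat.DivMod as ℕ
import Data.Nat.Divisibility as ℕ
open import Data.Nat.Induction using (Acc; acc; <-wellFounded)
open import Data.Nat.ListAction using (product)
open import Data.Nat.Primality using (prime?; euclidsLemma; irreducible[2]; prime⇒irreducible; prime⇒nonZero; prime⇒nonTrivial; ¬prime[1]; ¬prime⇒composite; composite)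
open import Data.Nat.Primality.Factorisation using (PrimeFactorisation; factorise)
import Data.Nat.Properties as ℕ
import Data.Nat.Tactic.RingSolver as ℕSolver
open import Data.Product using (∃; ∃₂; _,_; proj₁; proj₂)
open import Data.Sum using (_⊎_; inj₁; inj₂; [_,_]′)
open import Data.Unit using (⊤; tt)
open import Data.Vec using (Vec; []; _∷_)
open import Data.Vec.Relation.Unary.All as VecAll using ([]; _∷_)
open import Function using (_∘_; case_of_)
open import Relation.Binary.Definitions using (tri<; tri≈; tri>)
open import Relation.Binary.PropositionalEquality
open import Relation.Nullary
open import Relation.Nullary.Decidable using (_×-dec_; ¬?; map′; from-no; from-yes)
open import Relation.Unary using (Decidable)

-- Four squares and quaternions

-- The prime p > 3 rules out forced summands: 14·4^k has, up to order and sign, the single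
-- representation 4^k (9 + 4 + 1 + 0), so no argument can avoid 3·2^k there. But a vector on the ray
-- of (3,2,1,0) whose first entry is divisible by p is itself divisible by p, and primitivity
-- excludes it.
--
-- Reflections in vectors of norm 1 and 2 only permute coordinates and change signs, so 3 is the
-- least norm that yields new representations. The only denominators are then powers of 3, prime to
-- p, and integrality depends on finitely many residue classes.
--
-- A class (*,0,0,0) modulo 3 with * prime to 3 is an obstacle: only the reflections in (0,±1,±1,±1)
-- are integral there, and they fix x₀.
--
-- The case analysis is too large to write out, so it is computed. The search carries its own proof,
-- and whether it succeeds depends on the modulus, the residues and the spanning vectors, but not on
-- x; a single evaluation settles all x of a class.

record V : Set where
  constructor ⟨_,_,_,_⟩
  field a b c d : ℤ

infixl 7 _·_ _⊗_

_·_ : V → V → ℤ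
⟨ a , b , c , d ⟩ · ⟨ e , f , g , h ⟩ = a * e + b * f + c * g + d * h

norm : V → ℤ
norm x = x · x

_⊗_ : V → V → V
⟨ a , b , c , d ⟩ ⊗ ⟨ e , f , g , h ⟩ =
  ⟨ a * e - b * f - c * g - d * h , a * f + b * e + c * h - d * g
  , a * g - b * h + c * e + d * f , a * h + b * g - c * f + d * e ⟩

conj : V → V
conj ⟨ a , b , c , d ⟩ = ⟨ a , - b , - c , - d ⟩

scale : ℤ → V → V
scale k ⟨ a , b , c , d ⟩ = ⟨ k * a , k * b , k * c , k * d ⟩

norm-⊗ : ∀ x y → norm (x ⊗ y) ≡ norm x * norm y
norm-⊗ ⟨ a , b , c , d ⟩ ⟨ e , f , g , h ⟩ = euler a b c d e f g h
  where
  euler : ∀ a b c d e f g h →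
    (a * e - b * f - c * g - d * h) * (a * e - b * f - c * g - d * h)
    + (a * f + b * e + c * h - d * g) * (a * f + b * e + c * h - d * g)
    + (a * g - b * h + c * e + d * f) * (a * g - b * h + c * e + d * f)
    + (a * h + b * g - c * f + d * e) * (a * h + b * g - c * f + d * e)
    ≡ (a * a + b * b + c * c + d * d) * (e * e + f * f + g * g + h * h)
  euler = solve-∀

norm-conj : ∀ x → norm (conj x) ≡ norm x
norm-conj ⟨ a , b , c , d ⟩ = lemma a b c d
  where
  lemma : ∀ a b c d → a * a + - b * - b + - c * - c + - d * - d ≡ a * a + b * b + c * c + d * d
  lemma = solve-∀

norm-scale : ∀ k x → norm (scale k x) ≡ k * k * norm x
norm-scale k ⟨ a , b , c , d ⟩ = lemma k a b c d
  where
  lemma : ∀ k a b c d → k * a * (k * a) + k * b * (k * b) + k * c * (k * c) + k * d * (k * d)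
    ≡ k * k * (a * a + b * b + c * c + d * d)
  lemma = solve-∀

FourSquares : ℕ → Set
FourSquares n = ∃ λ x → norm x ≡ + n

sq-abs : ∀ i → i * i ≡ + (∣ i ∣ ℕ.* ∣ i ∣)
sq-abs (+ n)    = sym (ℤ.pos-* n n)
sq-abs -[1+ n ] = refl

normℕ : V → ℕ
normℕ ⟨ a , b , c , d ⟩ =
  ∣ a ∣ ℕ.* ∣ a ∣ ℕ.+ ∣ b ∣ ℕ.* ∣ b ∣ ℕ.+ ∣ c ∣ ℕ.* ∣ c ∣ ℕ.+ ∣ d ∣ ℕ.* ∣ d ∣

norm≡normℕ : ∀ x → norm x ≡ + normℕ x
norm≡normℕ ⟨ a , b , c , d ⟩ =
  cong₂ _+_ (cong₂ _+_ (cong₂ _+_ (sq-abs a) (sq-abs b)) (sq-abs c)) (sq-abs d)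

fourSquares-* : ∀ {m n} → FourSquares m → FourSquares n → FourSquares (m ℕ.* n)
fourSquares-* {m} {n} (x , p) (y , q) =
  x ⊗ y , trans (norm-⊗ x y) (trans (cong₂ _*_ p q) (sym (ℤ.pos-* m n)))

-- The remainder of least absolute value. Bounding 2 |y| instead of |y| spares a distinction between
-- even and odd m.
balanced : ∀ m .{{_ : ℕ.NonZero m}} t → ∃₂ λ y k → t ≡ y + k * + m × 2 ℕ.* ∣ y ∣ ℕ.≤ m
balanced m t with 2 ℕ.* (t %ℕ m) ℕ.≤? m
... | yes small = + (t %ℕ m) , t /ℕ m , a≡a%ℕn+[a/ℕn]*n t m , small
... | no large = + r - + m , t /ℕ m + 1ℤ , eq , bound
  where
  r = t %ℕ m
  shift : ∀ r q m → r + q * m ≡ (r - m) + (q + 1ℤ) * m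
  shift = solve-∀
  eq = trans (a≡a%ℕn+[a/ℕn]*n t m) (shift (+ r) (t /ℕ m) (+ m))
  r≤m : r ℕ.≤ m
  r≤m = ℕ.<⇒≤ (n%ℕd<d t m)
  bound : 2 ℕ.* ∣ + r - + m ∣ ℕ.≤ m
  bound = begin
    2 ℕ.* ∣ + r - + m ∣        ≡⟨ cong (2 ℕ.*_) (trans (cong ∣_∣ (ℤ.m-n≡m⊖n r m)) (ℤ.∣⊖∣-≤ r≤m)) ⟩
    2 ℕ.* (m ℕ.∸ r)            ≡⟨ ℕ.*-distribˡ-∸ 2 m r ⟩
    2 ℕ.* m ℕ.∸ 2 ℕ.* r        ≤⟨ ℕ.∸-monoʳ-≤ (2 ℕ.* m) (ℕ.<⇒≤ (ℕ.≰⇒> large)) ⟩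
    2 ℕ.* m ℕ.∸ m              ≡⟨ cong (ℕ._∸ m) (cong (m ℕ.+_) (ℕ.+-identityʳ m)) ⟩
    m ℕ.+ m ℕ.∸ m              ≡⟨ ℕ.m+n∸n≡m m m ⟩
    m                          ∎
    where open ℕ.≤-Reasoning

sum≡0 : ∀ {a b c d} → a ℕ.+ b ℕ.+ c ℕ.+ d ≡ 0 → a ≡ 0 × b ≡ 0 × c ≡ 0 × d ≡ 0
sum≡0 {a} {b} {c} eq =
  let p = ℕ.m+n≡0⇒m≡0 (a ℕ.+ b ℕ.+ c) eq
      q = ℕ.m+n≡0⇒m≡0 (a ℕ.+ b) p
  in ℕ.m+n≡0⇒m≡0 a q , ℕ.m+n≡0⇒n≡0 a q , ℕ.m+n≡0⇒n≡0 (a ℕ.+ b) p , ℕ.m+n≡0⇒n≡0 (a ℕ.+ b ℕ.+ c) eq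

square≡0 : ∀ {m} → m ℕ.* m ≡ 0 → m ≡ 0
square≡0 {m} eq = [ (λ z → z) , (λ z → z) ]′ (ℕ.m*n≡0⇒m≡0∨n≡0 m eq)

normℕ≡0 : ∀ {a b c d} → normℕ ⟨ a , b , c , d ⟩ ≡ 0 → a ≡ 0ℤ × b ≡ 0ℤ × c ≡ 0ℤ × d ≡ 0ℤ
normℕ≡0 {a} {b} {c} {d} eq with sum≡0 eq
... | p , q , r , s = zero-abs a p , zero-abs b q , zero-abs c r , zero-abs d s
  where
  zero-abs : ∀ i → ∣ i ∣ ℕ.* ∣ i ∣ ≡ 0 → i ≡ 0ℤ
  zero-abs i = ℤ.∣i∣≡0⇒i≡0 ∘ square≡0

square-injective : ∀ {m n} → m ℕ.* m ≡ n ℕ.* n → m ≡ n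
square-injective {m} {n} eq with ℕ.<-cmp m n
... | tri< m<n _ _ = contradiction eq (ℕ.<⇒≢ (ℕ.*-mono-< m<n m<n))
... | tri≈ _ m≡n _ = m≡n
... | tri> _ _ n<m = contradiction (sym eq) (ℕ.<⇒≢ (ℕ.*-mono-< n<m n<m))

-- None of four terms bounded by M can fall short when the sum is 4M. This serves the equality case
-- r = m of the descent.
saturated : ∀ {M a b c d} → a ℕ.≤ M → b ℕ.≤ M → c ℕ.≤ M → d ℕ.≤ M →
            a ℕ.+ b ℕ.+ c ℕ.+ d ≡ M ℕ.+ M ℕ.+ M ℕ.+ M → a ≡ M
saturated {M} {a} {b} {c} {d} a≤M b≤M c≤M d≤M eq = ℕ.≤-antisym a≤M (ℕ.+-cancelʳ-≤ (M ℕ.+ M ℕ.+ M) M a (begin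
  M ℕ.+ (M ℕ.+ M ℕ.+ M)     ≡⟨ assoc M M M M ⟩
  M ℕ.+ M ℕ.+ M ℕ.+ M       ≡⟨ eq ⟨
  a ℕ.+ b ℕ.+ c ℕ.+ d       ≡⟨ assoc a b c d ⟨
  a ℕ.+ (b ℕ.+ c ℕ.+ d)     ≤⟨ ℕ.+-monoʳ-≤ a (ℕ.+-mono-≤ (ℕ.+-mono-≤ b≤M c≤M) d≤M) ⟩
  a ℕ.+ (M ℕ.+ M ℕ.+ M)     ∎))
  where
  open ℕ.≤-Reasoning
  assoc : ∀ a b c d → a ℕ.+ (b ℕ.+ c ℕ.+ d) ≡ a ℕ.+ b ℕ.+ c ℕ.+ d
  assoc = ℕSolver.solve-∀

norm-shift : ∀ a b c d e f g h m →
  (a + e * m) * (a + e * m) + (b + f * m) * (b + f * m) + (c + g * m) * (c + g * m) + (d + h * m) * (d + h * m)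
  ≡ (a * a + b * b + c * c + d * d) + (e * (+ 2 * a) + f * (+ 2 * b) + g * (+ 2 * c) + h * (+ 2 * d) + (e * e + f * f + g * g + h * h) * m) * m
norm-shift = solve-∀

⟨⟩-cong : ∀ {a b c d a′ b′ c′ d′} → a ≡ a′ → b ≡ b′ → c ≡ c′ → d ≡ d′ → ⟨ a , b , c , d ⟩ ≡ ⟨ a′ , b′ , c′ , d′ ⟩
⟨⟩-cong refl refl refl refl = refl

quotient-of-sum : ∀ m p r u {N S} .{{_ : NonZero m}} → m * p ≡ N → N ≡ S + u * m → S ≡ r * m → p ≡ r + u
quotient-of-sum m p r u refl N≡ refl = ℤ.*-cancelʳ-≡ p (r + u) m
  (trans (ℤ.*-comm p m) (trans N≡ (sym (ℤ.*-distribʳ-+ m r u))))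

norm-of-quotient : ∀ m p r w z .{{_ : NonZero m}} → scale m w ≡ z → norm z ≡ m * p * (r * m) → norm w ≡ r * p
norm-of-quotient m p r w _ refl eq = ℤ.*-cancelˡ-≡ m (norm w) (r * p) (ℤ.*-cancelˡ-≡ m (m * norm w) (m * (r * p))
  (trans (sym (ℤ.*-assoc m m (norm w))) (trans (sym (norm-scale m w)) (trans eq (regroup m p r)))))
  where
  regroup : ∀ m p r → m * p * (r * m) ≡ m * (m * (r * p))
  regroup = solve-∀

-- Fermat descent on the multiples of a prime p that are sums of four squares

module Descent {p : ℕ} (pp : Prime p) where

  -- x = y + m k with y balanced modulo m and norm y = r m; then x ⊗ conj y = m w with norm w = r p.
  module Step (m : ℕ) .{{_ : ℕ.NonZero m}} (1<m : 1 ℕ.< m) (m<p : m ℕ.< p)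
              (a b c d e f g h : ℤ)
              (a≤ : 2 ℕ.* ∣ a ∣ ℕ.≤ m) (b≤ : 2 ℕ.* ∣ b ∣ ℕ.≤ m) (c≤ : 2 ℕ.* ∣ c ∣ ℕ.≤ m) (d≤ : 2 ℕ.* ∣ d ∣ ℕ.≤ m)
              (eq : norm ⟨ a + e * + m , b + f * + m , c + g * + m , d + h * + m ⟩ ≡ + m * + p) where

    x y k 2y : V
    x  = ⟨ a + e * + m , b + f * + m , c + g * + m , d + h * + m ⟩
    y  = ⟨ a , b , c , d ⟩
    k  = ⟨ e , f , g , h ⟩
    2y = scale (+ 2) y

    m∣norm-y : m ℕ.∣ normℕ y
    m∣norm-y = ∣⇒∣ᵤ (subst (+ m ∣ℤ_) (norm≡normℕ y)
      (∣m+n∣n⇒∣m (subst (+ m ∣ℤ_) (trans (sym eq) (norm-shift a b c d e f g h (+ m))) (∣m⇒∣m*n (+ p) ∣-refl))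
                 (∣n⇒∣m*n (k · 2y + norm k * + m) ∣-refl)))

    r = ℕ.quotient m∣norm-y

    norm-y : norm y ≡ + r * + m
    norm-y = trans (norm≡normℕ y) (trans (cong +_ (ℕ._∣_.equality m∣norm-y)) (ℤ.pos-* r m))

    p-expansion : + p ≡ + r + (k · 2y + norm k * + m)
    p-expansion = quotient-of-sum (+ m) (+ p) (+ r) (k · 2y + norm k * + m) (sym eq) (norm-shift a b c d e f g h (+ m)) norm-y

    -- By `p-expansion` these divisibilities force m ∣ p, impossible for 1 < m < p. Both extremes r
    -- = 0 and r = m end here. Doubled coordinates are enough, since the cross term is k · 2y, and
    -- they are all that r = m provides.
    m∣p-absurd : + m ∣ℤ + r → + m ∣ℤ + 2 * a → + m ∣ℤ + 2 * b → + m ∣ℤ + 2 * c → + m ∣ℤ + 2 * d → FourSquares p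
    m∣p-absurd m∣r ma mb mc md = case prime⇒irreducible pp (∣⇒∣ᵤ {+ m} {+ p} m∣p) of λ where
        (inj₁ m≡1) → contradiction (sym m≡1) (ℕ.<⇒≢ 1<m)
        (inj₂ m≡p) → contradiction m≡p (ℕ.<⇒≢ m<p)
      where
      m∣p : + m ∣ℤ + p
      m∣p = subst (+ m ∣ℤ_) (sym p-expansion) (∣m∣n⇒∣m+n m∣r (∣m∣n⇒∣m+n
        (∣m∣n⇒∣m+n (∣m∣n⇒∣m+n (∣m∣n⇒∣m+n (∣n⇒∣m*n e ma) (∣n⇒∣m*n f mb)) (∣n⇒∣m*n g mc)) (∣n⇒∣m*n h md))
        (∣n⇒∣m*n (norm k) ∣-refl)))

    4normℕ : ∀ a b c d → 2 ℕ.* a ℕ.* (2 ℕ.* a) ℕ.+ 2 ℕ.* b ℕ.* (2 ℕ.* b) ℕ.+ 2 ℕ.* c ℕ.* (2 ℕ.* c) ℕ.+ 2 ℕ.* d ℕ.* (2 ℕ.* d)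
      ≡ 4 ℕ.* (a ℕ.* a ℕ.+ b ℕ.* b ℕ.+ c ℕ.* c ℕ.+ d ℕ.* d)
    4normℕ = ℕSolver.solve-∀

    doubles : 2 ℕ.* ∣ a ∣ ℕ.* (2 ℕ.* ∣ a ∣) ℕ.+ 2 ℕ.* ∣ b ∣ ℕ.* (2 ℕ.* ∣ b ∣) ℕ.+ 2 ℕ.* ∣ c ∣ ℕ.* (2 ℕ.* ∣ c ∣) ℕ.+ 2 ℕ.* ∣ d ∣ ℕ.* (2 ℕ.* ∣ d ∣)
      ≡ 4 ℕ.* (r ℕ.* m)
    doubles = trans (4normℕ (∣ a ∣) (∣ b ∣) (∣ c ∣) (∣ d ∣)) (cong (4 ℕ.*_) (ℕ._∣_.equality m∣norm-y))

    fourfold : ∀ M → 4 ℕ.* M ≡ M ℕ.+ M ℕ.+ M ℕ.+ M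
    fourfold = ℕSolver.solve-∀

    r≤m : r ℕ.≤ m
    r≤m = ℕ.*-cancelʳ-≤ r m m (ℕ.*-cancelˡ-≤ 4 (begin
      4 ℕ.* (r ℕ.* m) ≡⟨ doubles ⟨
      _               ≤⟨ ℕ.+-mono-≤ (ℕ.+-mono-≤ (ℕ.+-mono-≤ (ℕ.*-mono-≤ a≤ a≤) (ℕ.*-mono-≤ b≤ b≤)) (ℕ.*-mono-≤ c≤ c≤)) (ℕ.*-mono-≤ d≤ d≤) ⟩
      m ℕ.* m ℕ.+ m ℕ.* m ℕ.+ m ℕ.* m ℕ.+ m ℕ.* m ≡⟨ fourfold (m ℕ.* m) ⟨
      4 ℕ.* (m ℕ.* m) ∎))
      where open ℕ.≤-Reasoning

    module Extremal where
      rotate : ∀ a b c d → b ℕ.+ c ℕ.+ d ℕ.+ a ≡ a ℕ.+ b ℕ.+ c ℕ.+ d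
      rotate = ℕSolver.solve-∀

      full : ∀ i → 2 ℕ.* ∣ i ∣ ℕ.* (2 ℕ.* ∣ i ∣) ≡ m ℕ.* m → + m ∣ℤ + 2 * i
      full i eq = ∣ᵤ⇒∣ (subst (m ℕ.∣_) (trans (sym (square-injective eq)) (sym (ℤ.abs-* (+ 2) i))) ℕ.∣-refl)

      extremal : r ≡ m → FourSquares p
      extremal r≡m = m∣p-absurd (subst (λ s → + m ∣ℤ + s) (sym r≡m) ∣-refl)
          (full a (saturated A B C D sum))
          (full b (saturated B C D A (trans (rotate (sq a) (sq b) (sq c) (sq d)) sum)))
          (full c (saturated C D A B (trans (rotate (sq b) (sq c) (sq d) (sq a)) (trans (rotate (sq a) (sq b) (sq c) (sq d)) sum))))
          (full d (saturated D A B C (trans (sym (rotate (sq d) (sq a) (sq b) (sq c))) sum)))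
        where
        sq : ℤ → ℕ
        sq i = 2 ℕ.* ∣ i ∣ ℕ.* (2 ℕ.* ∣ i ∣)
        A = ℕ.*-mono-≤ a≤ a≤
        B = ℕ.*-mono-≤ b≤ b≤
        C = ℕ.*-mono-≤ c≤ c≤
        D = ℕ.*-mono-≤ d≤ d≤
        sum = trans doubles (trans (cong (λ s → 4 ℕ.* (s ℕ.* m)) r≡m) (fourfold (m ℕ.* m)))

    vanishing : r ≡ 0 → FourSquares p
    vanishing r≡0 = conclude (normℕ≡0 {a} {b} {c} {d} (trans (ℕ._∣_.equality m∣norm-y) (cong (ℕ._* m) r≡0)))
      where
      twice : ∀ i → i ≡ 0ℤ → + m ∣ℤ + 2 * i
      twice i i≡0 = divides 0ℤ (cong (+ 2 *_) i≡0)
      conclude : a ≡ 0ℤ × b ≡ 0ℤ × c ≡ 0ℤ × d ≡ 0ℤ → FourSquares p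
      conclude (a≡0 , b≡0 , c≡0 , d≡0) =
        m∣p-absurd (divides 0ℤ (cong +_ r≡0)) (twice a a≡0) (twice b b≡0) (twice c c≡0) (twice d d≡0)

    w : V
    w = ⟨ + r + (e * a + f * b + g * c + h * d) , f * a - e * b + h * c - g * d
        , g * a - e * c + f * d - h * b , h * a - e * d + g * b - f * c ⟩

    w-norm : norm w ≡ + r * + p
    w-norm = norm-of-quotient (+ m) (+ p) (+ r) w (x ⊗ conj y) mw
      (trans (norm-⊗ x (conj y)) (cong₂ _*_ eq (trans (norm-conj y) norm-y)))
      where
      i₀ : ∀ a b c d e f g h m → (a * a + b * b + c * c + d * d) + m * (e * a + f * b + g * c + h * d) ≡
        (a + e * m) * a - (b + f * m) * - b - (c + g * m) * - c - (d + h * m) * - d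
      i₀ = solve-∀
      i₁ : ∀ a b c d e f g h m → m * (f * a - e * b + h * c - g * d) ≡
        (a + e * m) * - b + (b + f * m) * a + (c + g * m) * - d - (d + h * m) * - c
      i₁ = solve-∀
      i₂ : ∀ a b c d e f g h m → m * (g * a - e * c + f * d - h * b) ≡
        (a + e * m) * - c - (b + f * m) * - d + (c + g * m) * a + (d + h * m) * - b
      i₂ = solve-∀
      i₃ : ∀ a b c d e f g h m → m * (h * a - e * d + g * b - f * c) ≡
        (a + e * m) * - d + (b + f * m) * - c - (c + g * m) * - b + (d + h * m) * a
      i₃ = solve-∀
      absorb : ∀ m r S u → S ≡ r * m → m * (r + u) ≡ S + m * u
      absorb m r S u refl = trans (ℤ.*-distribˡ-+ m r u) (cong (_+ m * u) (ℤ.*-comm m r))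
      mw : scale (+ m) w ≡ x ⊗ conj y
      mw = ⟨⟩-cong
        (trans (absorb (+ m) (+ r) (norm y) (k · y) norm-y) (i₀ a b c d e f g h (+ m)))
        (i₁ a b c d e f g h (+ m)) (i₂ a b c d e f g h (+ m)) (i₃ a b c d e f g h (+ m))

    conclude : (∀ s → s ℕ.< m → 0 ℕ.< s → ∀ v → norm v ≡ + s * + p → FourSquares p) → FourSquares p
    conclude recurse = cases (r ℕ.≟ 0) (ℕ.m≤n⇒m<n∨m≡n r≤m)
      where
      cases : Dec (r ≡ 0) → r ℕ.< m ⊎ r ≡ m → FourSquares p
      cases (yes r≡0) _          = vanishing r≡0
      cases (no r≢0)  (inj₁ r<m) = recurse r r<m (ℕ.n≢0⇒n>0 r≢0) w w-norm
      cases (no _)    (inj₂ r≡m) = Extremal.extremal r≡m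

  Balanced : ℕ → ℤ → Set
  Balanced m t = ∃₂ λ y k → t ≡ y + k * + m × 2 ℕ.* ∣ y ∣ ℕ.≤ m

  descent : ∀ m → Acc ℕ._<_ m → 0 ℕ.< m → m ℕ.< p → ∀ x → norm x ≡ + m * + p → FourSquares p
  descent m (acc rs) 0<m m<p x@(⟨ x₀ , x₁ , x₂ , x₃ ⟩) eq =
    [ (λ 1<m → reduce 1<m (balanced m x₀) (balanced m x₁) (balanced m x₂) (balanced m x₃))
    , (λ 1≡m → x , trans eq (trans (cong (λ s → + s * + p) (sym 1≡m)) (ℤ.*-identityˡ (+ p)))) ]′ (ℕ.m≤n⇒m<n∨m≡n 0<m)
    where
    instance _ = ℕ.>-nonZero 0<m
    reduce : 1 ℕ.< m → Balanced m x₀ → Balanced m x₁ → Balanced m x₂ → Balanced m x₃ → FourSquares p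
    reduce 1<m (a , e , p₀ , a≤) (b , f , p₁ , b≤) (c , g , p₂ , c≤) (d , h , p₃ , d≤) =
      Step.conclude m 1<m m<p a b c d e f g h a≤ b≤ c≤ d≤
        (trans (cong norm (sym (⟨⟩-cong p₀ p₁ p₂ p₃))) eq)
        (λ s s<m 0<s → descent s (rs s<m) 0<s (ℕ.<-trans s<m m<p))

euclid : ∀ {p} → Prime p → ∀ i j → + p ∣ℤ i * j → (+ p ∣ℤ i) ⊎ (+ p ∣ℤ j)
euclid pp i j p∣ij = [ inj₁ ∘ ∣ᵤ⇒∣ , inj₂ ∘ ∣ᵤ⇒∣ ]′
  (euclidsLemma (∣ i ∣) (∣ j ∣) pp (subst (_ ℕ.∣_) (ℤ.abs-* i j) (∣⇒∣ᵤ p∣ij)))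

small-multiple : ∀ {p n} → p ℕ.∣ n → n ℕ.< p → n ≡ 0
small-multiple {n = zero}  _   _   = refl
small-multiple {n = suc n} p∣n n<p = contradiction (ℕ.∣⇒≤ p∣n) (ℕ.<⇒≱ n<p)

same-remainder : ∀ p .{{_ : ℕ.NonZero p}} i j → i %ℕ p ≡ j %ℕ p → + p ∣ℤ i - j
same-remainder p i j eq = divides (i /ℕ p - j /ℕ p)
  (difference (+ (i %ℕ p)) (+ (j %ℕ p)) (i /ℕ p) (j /ℕ p) (+ p)
    (a≡a%ℕn+[a/ℕn]*n i p) (a≡a%ℕn+[a/ℕn]*n j p) (cong +_ eq))
  where
  cancel : ∀ r q q′ m → r + q * m - (r + q′ * m) ≡ (q - q′) * m
  cancel = solve-∀
  difference : ∀ r r′ q q′ m {i j} → i ≡ r + q * m → j ≡ r′ + q′ * m → r ≡ r′ → i - j ≡ (q - q′) * m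
  difference r _ q q′ m refl refl refl = cancel r q q′ m

-- Minus one as a sum of two squares modulo an odd prime, and the start of the descent

module MinusOne {p h : ℕ} (pp : Prime p) (p≡ : p ≡ suc (h ℕ.+ h)) where

  instance _ = prime⇒nonZero pp

  squares-distinct : ∀ i j → i ℕ.≤ h → j ℕ.≤ h → + p ∣ℤ + i * + i - + j * + j → i ≡ j
  squares-distinct i j i≤h j≤h p∣ = [ difference , total ]′
      (euclid pp (+ i - + j) (+ i + + j) (subst (+ p ∣ℤ_) (factor (+ i) (+ j)) p∣))
    where
    factor : ∀ i j → i * i - j * j ≡ (i - j) * (i + j)
    factor = solve-∀
    h<p : h ℕ.< p
    h<p = subst (h ℕ.<_) (sym p≡) (s≤s (ℕ.m≤m+n h h))
    difference : + p ∣ℤ + i - + j → i ≡ j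
    difference p∣ = ℤ.+-injective (ℤ.i-j≡0⇒i≡j (+ i) (+ j) (ℤ.∣i∣≡0⇒i≡0 (small-multiple (∣⇒∣ᵤ p∣)
      (ℕ.≤-<-trans (subst (λ t → ∣ t ∣ ℕ.≤ i ℕ.⊔ j) (sym (ℤ.m-n≡m⊖n i j)) (ℤ.∣m⊝n∣≤m⊔n i j))
        (ℕ.≤-<-trans (ℕ.⊔-lub i≤h j≤h) h<p)))))
    total : + p ∣ℤ + i + + j → i ≡ j
    total p∣ = trans (ℕ.m+n≡0⇒m≡0 i both) (sym (ℕ.m+n≡0⇒n≡0 i both))
      where
      both : i ℕ.+ j ≡ 0
      both = small-multiple (∣⇒∣ᵤ {+ p} {+ (i ℕ.+ j)} p∣) (subst (i ℕ.+ j ℕ.<_) (sym p≡) (s≤s (ℕ.+-mono-≤ i≤h j≤h)))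

  value : Fin (suc h) ⊎ Fin (suc h) → ℤ
  value (inj₁ i) = + toℕ i * + toℕ i
  value (inj₂ j) = - (1ℤ + + toℕ j * + toℕ j)

  residue : Fin (suc h ℕ.+ suc h) → Fin p
  residue k = fromℕ< (n%ℕd<d (value (splitAt (suc h) k)) p)

  Solution : Set
  Solution = ∃₂ λ i j → i ℕ.≤ h × j ℕ.≤ h × + p ∣ℤ 1ℤ + + i * + i + + j * + j

  from-collision : ∀ s t → s ≢ t → + p ∣ℤ value s - value t → Solution
  from-collision (inj₁ i) (inj₁ j) s≢t p∣ = contradiction
    (cong inj₁ (Fin.toℕ-injective (squares-distinct (toℕ i) (toℕ j) (Fin.toℕ≤pred[n] i) (Fin.toℕ≤pred[n] j) p∣))) s≢t
  from-collision (inj₂ i) (inj₂ j) s≢t p∣ = contradiction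
    (cong inj₂ (Fin.toℕ-injective (sym (squares-distinct (toℕ j) (toℕ i) (Fin.toℕ≤pred[n] j) (Fin.toℕ≤pred[n] i)
      (subst (+ p ∣ℤ_) (swap (+ toℕ i) (+ toℕ j)) p∣))))) s≢t
    where
    swap : ∀ i j → - (1ℤ + i * i) - - (1ℤ + j * j) ≡ j * j - i * i
    swap = solve-∀
  from-collision (inj₁ i) (inj₂ j) _ p∣ = toℕ i , toℕ j , Fin.toℕ≤pred[n] i , Fin.toℕ≤pred[n] j ,
    subst (+ p ∣ℤ_) (rearrange (+ toℕ i) (+ toℕ j)) p∣
    where
    rearrange : ∀ i j → i * i - - (1ℤ + j * j) ≡ 1ℤ + i * i + j * j
    rearrange = solve-∀
  from-collision (inj₂ i) (inj₁ j) _ p∣ = toℕ i , toℕ j , Fin.toℕ≤pred[n] i , Fin.toℕ≤pred[n] j ,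
    subst (+ p ∣ℤ_) (rearrange (+ toℕ i) (+ toℕ j)) (∣m⇒∣-m p∣)
    where
    rearrange : ∀ i j → - (- (1ℤ + i * i) - j * j) ≡ 1ℤ + i * i + j * j
    rearrange = solve-∀

  -- The h + 1 numbers i² and the h + 1 numbers -1 - j² are one more than the p = 2h + 1 residues.
  -- Each family is injective modulo p, so a collision must pair the two families.
  solution : Solution
  solution with Fin.pigeonhole (subst (ℕ._< suc h ℕ.+ suc h) (sym p≡) (s≤s (ℕ.≤-reflexive (sym (ℕ.+-suc h h))))) residue
  ... | k , l , k<l , collision = from-collision (splitAt (suc h) k) (splitAt (suc h) l)
      (λ eq → Fin.<⇒≢ k<l (trans (sym (Fin.join-splitAt (suc h) (suc h) k))
        (trans (cong (join (suc h) (suc h)) eq) (Fin.join-splitAt (suc h) (suc h) l))))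
      (same-remainder p (value (splitAt (suc h) k)) (value (splitAt (suc h) l))
        (Fin.fromℕ<-injective _ _ _ _ collision))

  fourSquares : FourSquares p
  fourSquares = from-solution solution
    where
    from-solution : Solution → FourSquares p
    from-solution (i , j , i≤h , j≤h , p∣) = Descent.descent pp m (<-wellFounded m) 0<m m<p x norm-x
      where
      N = suc (i ℕ.* i ℕ.+ j ℕ.* j)
      x = ⟨ 1ℤ , + i , + j , 0ℤ ⟩
      x-norm : 1ℤ + + i * + i + + j * + j + 0ℤ ≡ + N
      x-norm = trans (ℤ.+-identityʳ _) (cong₂ (λ s t → 1ℤ + s + t) (sym (ℤ.pos-* i i)) (sym (ℤ.pos-* j j)))
      p∣N : p ℕ.∣ N
      p∣N = ∣⇒∣ᵤ {+ p} {+ N} (subst (+ p ∣ℤ_) (trans (sym (ℤ.+-identityʳ _)) x-norm) p∣)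
      m = ℕ.quotient p∣N
      N≡ : N ≡ m ℕ.* p
      N≡ = ℕ._∣_.equality p∣N
      norm-x : norm x ≡ + m * + p
      norm-x = trans x-norm (trans (cong +_ N≡) (ℤ.pos-* m p))
      0<m : 0 ℕ.< m
      0<m = ℕ.n≢0⇒n>0 λ m≡0 → ℕ.1+n≢0 (trans N≡ (cong (ℕ._* p) m≡0))
      m<p : m ℕ.< p
      -- The restriction to i, j ≤ h pays off here: m p = 1 + i² + j² ≤ 1 + 2h² stays below p².
      m<p = ℕ.*-cancelʳ-< p m p (begin-strict
        m ℕ.* p                         ≡⟨ N≡ ⟨
        suc (i ℕ.* i ℕ.+ j ℕ.* j)       ≤⟨ s≤s (ℕ.+-mono-≤ (ℕ.*-mono-≤ i≤h i≤h) (ℕ.*-mono-≤ j≤h j≤h)) ⟩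
        1 ℕ.+ (h ℕ.* h ℕ.+ h ℕ.* h)     ≡⟨ cong suc (ℕ.*-distribʳ-+ h h h) ⟨
        1 ℕ.+ (h ℕ.+ h) ℕ.* h           <⟨ ℕ.+-mono-<-≤ (ℕ.nonTrivial⇒n>1 p {{prime⇒nonTrivial pp}})
                                             (ℕ.*-monoʳ-≤ (h ℕ.+ h) (ℕ.≤-trans (ℕ.m≤m+n h h) (ℕ.n≤1+n _))) ⟩
        p ℕ.+ (h ℕ.+ h) ℕ.* suc (h ℕ.+ h) ≡⟨ cong (λ q → p ℕ.+ (h ℕ.+ h) ℕ.* q) p≡ ⟨
        suc (h ℕ.+ h) ℕ.* p             ≡⟨ cong (ℕ._* p) p≡ ⟨
        p ℕ.* p ∎)
        where open ℕ.≤-Reasoning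

fourSquares-prime : ∀ {p} → Prime p → FourSquares p
fourSquares-prime {p} pp with p ℕ.% 2 in eq | ℕ.m%n<n p 2 | ℕ.m≡m%n+[m/n]*n p 2
... | 0 | _ | p≡ = [ (λ ()) , (λ { refl → ⟨ 1ℤ , 1ℤ , 0ℤ , 0ℤ ⟩ , refl }) ]′
  (prime⇒irreducible pp (ℕ.m%n≡0⇒n∣m p 2 eq))
... | 1 | _ | p≡ = MinusOne.fourSquares {h = p ℕ./ 2} pp (trans p≡ (cong suc (double (p ℕ./ 2))))
  where
  double : ∀ h → h ℕ.* 2 ≡ h ℕ.+ h
  double = ℕSolver.solve-∀
... | suc (suc _) | s≤s (s≤s ()) | _

lagrange : ∀ n → FourSquares n
lagrange n = go n (<-wellFounded n)
  where
  go : ∀ n → Acc ℕ._<_ n → FourSquares n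
  go 0 _ = ⟨ 0ℤ , 0ℤ , 0ℤ , 0ℤ ⟩ , refl
  go 1 _ = ⟨ 1ℤ , 0ℤ , 0ℤ , 0ℤ ⟩ , refl
  go n@(suc (suc _)) (acc rs) with prime? n
  ... | yes pp = fourSquares-prime pp
  ... | no ¬pp with ¬prime⇒composite ¬pp
  ...   | composite {d} d<n d∣n = subst FourSquares (sym (ℕ._∣_.equality d∣n))
            (fourSquares-* (go (ℕ.quotient d∣n) (rs (ℕ.quotient-< d∣n))) (go d (rs d<n)))

-- Representations that are primitive at p

infix 4 _∣ᵥ_ _∣ᵥ?_

_∣ᵥ_ : ℤ → V → Set
m ∣ᵥ ⟨ a , b , c , d ⟩ = (m ∣ℤ a) × (m ∣ℤ b) × (m ∣ℤ c) × (m ∣ℤ d)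

_∣ᵥ?_ : ∀ m x → Dec (m ∣ᵥ x)
m ∣ᵥ? ⟨ a , b , c , d ⟩ = (m ∣ℤ? a) ×-dec (m ∣ℤ? b) ×-dec (m ∣ℤ? c) ×-dec (m ∣ℤ? d)

∣ᵥ-quotient : ∀ {m x} → m ∣ᵥ x → ∃ λ y → x ≡ scale m y
∣ᵥ-quotient {m} (divides a refl , divides b refl , divides c refl , divides d refl) =
  ⟨ a , b , c , d ⟩ , ⟨⟩-cong (ℤ.*-comm a m) (ℤ.*-comm b m) (ℤ.*-comm c m) (ℤ.*-comm d m)

m*m∣norm : ∀ {m x} → m ∣ᵥ x → m * m ∣ℤ norm x
m*m∣norm {m} m∣x with ∣ᵥ-quotient m∣x
... | y , refl = divides (norm y) (trans (norm-scale m y) (ℤ.*-comm (m * m) (norm y)))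

module Primitive {p : ℕ} (pp : Prime p) (p∤2 : ¬ + p ∣ℤ + 2) where

  instance _ = prime⇒nonZero pp

  p∤ : ∀ {i j} → ¬ + p ∣ℤ i → ¬ + p ∣ℤ j → ¬ + p ∣ℤ i * j
  p∤ {i} {j} p∤i p∤j p∣ij = [ p∤i , p∤j ]′ (euclid pp i j p∣ij)

  SquareRoot : Set
  SquareRoot = ∃ λ z → norm z ≡ + p * + p × ¬ (+ p ∣ℤ V.a z)

  -- The quaternion square of a + bi + cj + dk, whose real part is 2a² − p.
  square : ∀ a b c d → norm ⟨ a , b , c , d ⟩ ≡ + p → ¬ + p ∣ℤ a → SquareRoot
  square a b c d eq p∤a =
    z , trans (z-norm a b c d) (cong₂ _*_ eq eq) ,
    λ p∣ → p∤ {+ 2} p∤2 (p∤ {a} p∤a p∤a) (∣m+n∣n⇒∣m {m = + 2 * (a * a)} p∣ (∣m⇒∣-m (∣-reflexive (sym eq))))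
    where
    z = ⟨ + 2 * (a * a) - norm ⟨ a , b , c , d ⟩ , + 2 * (a * b) , + 2 * (a * c) , + 2 * (a * d) ⟩
    z-norm : ∀ a b c d →
      (+ 2 * (a * a) - (a * a + b * b + c * c + d * d)) * (+ 2 * (a * a) - (a * a + b * b + c * c + d * d))
      + (+ 2 * (a * b)) * (+ 2 * (a * b)) + (+ 2 * (a * c)) * (+ 2 * (a * c)) + (+ 2 * (a * d)) * (+ 2 * (a * d))
      ≡ (a * a + b * b + c * c + d * d) * (a * a + b * b + c * c + d * d)
    z-norm = solve-∀

  p*p∤p : ¬ + p * + p ∣ℤ + p
  p*p∤p p²∣p = ℕ.<⇒≱ (ℕ.m<m*n p p (ℕ.nonTrivial⇒n>1 p {{prime⇒nonTrivial pp}}))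
    (ℕ.∣⇒≤ (subst (ℕ._∣ p) (ℤ.abs-* (+ p) (+ p)) (∣⇒∣ᵤ p²∣p)))

  -- If p divided all four coordinates of a vector of norm p, then p² would divide p. Some
  -- coordinate is thus prime to p, and a cyclic rotation makes it the real part.
  squareRoot : SquareRoot
  squareRoot = choose (lagrange p)
    where
    rotate : ∀ a b c d → b * b + c * c + d * d + a * a ≡ a * a + b * b + c * c + d * d
    rotate = solve-∀
    choose : FourSquares p → SquareRoot
    choose (⟨ a , b , c , d ⟩ , eq) with + p ∣ℤ? a
    ... | no p∤a = square a b c d eq p∤a
    ... | yes p∣a with + p ∣ℤ? b
    ... | no p∤b = square b c d a (trans (rotate a b c d) eq) p∤b
    ... | yes p∣b with + p ∣ℤ? c
    ... | no p∤c = square c d a b (trans (rotate b c d a) (trans (rotate a b c d) eq)) p∤c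
    ... | yes p∣c with + p ∣ℤ? d
    ... | no p∤d = square d a b c (trans (sym (rotate d a b c)) eq) p∤d
    ... | yes p∣d = contradiction (subst (+ p * + p ∣ℤ_) eq (m*m∣norm {x = ⟨ a , b , c , d ⟩} (p∣a , p∣b , p∣c , p∣d))) p*p∤p

  z = proj₁ squareRoot

  -- (y ⊗ z) + (y ⊗ conj z) is y scaled by twice the real part of z.
  one-primitive : ∀ y → ¬ + p ∣ᵥ y → ¬ (+ p ∣ᵥ y ⊗ z × + p ∣ᵥ y ⊗ conj z)
  one-primitive ⟨ a , b , c , d ⟩ p∤y ((p₀ , p₁ , p₂ , p₃) , (q₀ , q₁ , q₂ , q₃)) =
    p∤y (cancel a (subst (+ p ∣ℤ_) (i₀ a b c d (V.a z) (V.b z) (V.c z) (V.d z)) (∣m∣n⇒∣m+n p₀ q₀))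
        , cancel b (subst (+ p ∣ℤ_) (i₁ a b c d (V.a z) (V.b z) (V.c z) (V.d z)) (∣m∣n⇒∣m+n p₁ q₁))
        , cancel c (subst (+ p ∣ℤ_) (i₂ a b c d (V.a z) (V.b z) (V.c z) (V.d z)) (∣m∣n⇒∣m+n p₂ q₂))
        , cancel d (subst (+ p ∣ℤ_) (i₃ a b c d (V.a z) (V.b z) (V.c z) (V.d z)) (∣m∣n⇒∣m+n p₃ q₃)))
    where
    i₀ : ∀ a b c d e f g h → a * e - b * f - c * g - d * h + (a * e - b * - f - c * - g - d * - h) ≡ + 2 * e * a
    i₀ = solve-∀
    i₁ : ∀ a b c d e f g h → a * f + b * e + c * h - d * g + (a * - f + b * e + c * - h - d * - g) ≡ + 2 * e * b
    i₁ = solve-∀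
    i₂ : ∀ a b c d e f g h → a * g - b * h + c * e + d * f + (a * - g - b * - h + c * e + d * - f) ≡ + 2 * e * c
    i₂ = solve-∀
    i₃ : ∀ a b c d e f g h → a * h + b * g - c * f + d * e + (a * - h + b * - g - c * - f + d * e) ≡ + 2 * e * d
    i₃ = solve-∀
    cancel : ∀ i → + p ∣ℤ + 2 * V.a z * i → + p ∣ℤ i
    cancel i p∣ = [ (λ p∣2z → contradiction p∣2z (p∤ {+ 2} p∤2 (proj₂ (proj₂ squareRoot)))) , (λ p∣i → p∣i) ]′
      (euclid pp (+ 2 * V.a z) i p∣)

  PrimitiveRep : ℕ → Set
  PrimitiveRep n = ∃ λ x → norm x ≡ + n × ¬ + p ∣ᵥ x

  multiply : ∀ {n} → PrimitiveRep n → PrimitiveRep (p ℕ.* p ℕ.* n)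
  multiply {n} (y , eq , p∤y) = choose (+ p ∣ᵥ? y ⊗ z)
    where
    total : ∀ v → norm v ≡ + p * + p → norm (y ⊗ v) ≡ + (p ℕ.* p ℕ.* n)
    total v eq′ = trans (norm-⊗ y v) (trans (cong₂ _*_ eq eq′) (trans (ℤ.*-comm (+ n) (+ p * + p))
      (trans (cong (_* + n) (sym (ℤ.pos-* p p))) (sym (ℤ.pos-* (p ℕ.* p) n)))))
    choose : Dec (+ p ∣ᵥ y ⊗ z) → PrimitiveRep (p ℕ.* p ℕ.* n)
    choose (no p∤) = y ⊗ z , total z (proj₁ (proj₂ squareRoot)) , p∤
    choose (yes p∣) = y ⊗ conj z , total (conj z) (trans (norm-conj z) (proj₁ (proj₂ squareRoot))) ,
      λ p∣′ → one-primitive y p∤y (p∣ , p∣′)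

  -- Induction on n: if p divides the vector found by `lagrange`, then n = p² n′, and `multiply`
  -- lifts a primitive representation of the smaller n′.
  primitiveRep : ∀ n → .{{ℕ.NonZero n}} → PrimitiveRep n
  primitiveRep n = go n (<-wellFounded n)
    where
    go : ∀ n .{{_ : ℕ.NonZero n}} → Acc ℕ._<_ n → PrimitiveRep n
    go n (acc rs) = choose (lagrange n)
      where
      reduce : ∀ x → norm x ≡ + n → ∃ (λ y → x ≡ scale (+ p) y) → PrimitiveRep n
      reduce _ eq (y , refl) = subst PrimitiveRep (sym n≡) (multiply (go n′ {{n′≢0}} (rs n′<n)))
        where
        n′ = normℕ y
        n≡ : n ≡ p ℕ.* p ℕ.* n′
        n≡ = ℤ.+-injective (trans (sym eq) (trans (norm-scale (+ p) y)
          (trans (cong₂ _*_ (sym (ℤ.pos-* p p)) (norm≡normℕ y)) (sym (ℤ.pos-* (p ℕ.* p) n′)))))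
        n′≢0 : ℕ.NonZero n′
        n′≢0 = ℕ.≢-nonZero λ n′≡0 → ℕ.≢-nonZero⁻¹ n (trans n≡ (trans (cong (p ℕ.* p ℕ.*_) n′≡0) (ℕ.*-zeroʳ (p ℕ.* p))))
        instance _ = n′≢0
        n′<n : n′ ℕ.< n
        n′<n = subst (n′ ℕ.<_) (trans (ℕ.*-comm n′ (p ℕ.* p)) (sym n≡))
          (ℕ.m<m*n n′ (p ℕ.* p) (ℕ.<-≤-trans (ℕ.nonTrivial⇒n>1 p {{prime⇒nonTrivial pp}}) (ℕ.m≤m*n p p)))
      choose : FourSquares n → PrimitiveRep n
      choose (x , eq) with + p ∣ᵥ? x
      ... | no p∤x = x , eq , p∤x
      ... | yes p∣x = reduce x eq (∣ᵥ-quotient p∣x)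

-- Integral moves built from reflections

lin : ℤ → V → ℤ → V → V
lin k ⟨ a , b , c , d ⟩ l ⟨ e , f , g , h ⟩ = ⟨ k * a + l * e , k * b + l * f , k * c + l * g , k * d + l * h ⟩

lin-· : ∀ k f l g x → lin k f l g · x ≡ k * (f · x) + l * (g · x)
lin-· k ⟨ a , b , c , d ⟩ l ⟨ e , f , g , h ⟩ ⟨ x , y , z , w ⟩ = lemma k l a b c d e f g h x y z w
  where
  lemma : ∀ k l a b c d e f g h x y z w →
    (k * a + l * e) * x + (k * b + l * f) * y + (k * c + l * g) * z + (k * d + l * h) * w
    ≡ k * (a * x + b * y + c * z + d * w) + l * (e * x + f * y + g * z + h * w)
  lemma = solve-∀

·-lin : ∀ x k f l g → x · lin k f l g ≡ k * (x · f) + l * (x · g)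
·-lin ⟨ x , y , z , w ⟩ k ⟨ a , b , c , d ⟩ l ⟨ e , f , g , h ⟩ = lemma k l a b c d e f g h x y z w
  where
  lemma : ∀ k l a b c d e f g h x y z w →
    x * (k * a + l * e) + y * (k * b + l * f) + z * (k * c + l * g) + w * (k * d + l * h)
    ≡ k * (x * a + y * b + z * c + w * d) + l * (x * e + y * f + z * g + w * h)
  lemma = solve-∀

scale-· : ∀ k f x → scale k f · x ≡ k * (f · x)
scale-· k ⟨ a , b , c , d ⟩ ⟨ x , y , z , w ⟩ = lemma k a b c d x y z w
  where
  lemma : ∀ k a b c d x y z w →
    k * a * x + k * b * y + k * c * z + k * d * w ≡ k * (a * x + b * y + c * z + d * w)
  lemma = solve-∀

∣-· : ∀ {m y} f → m ∣ᵥ y → m ∣ℤ f · y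
∣-· ⟨ a , b , c , d ⟩ (p , q , r , s) =
  ∣m∣n⇒∣m+n (∣m∣n⇒∣m+n (∣m∣n⇒∣m+n (∣n⇒∣m*n a p) (∣n⇒∣m*n b q)) (∣n⇒∣m*n c r)) (∣n⇒∣m*n d s)

cancel-zero : ∀ {k i} → k ≢ 0ℤ → k * i ≡ 0ℤ → i ≡ 0ℤ
cancel-zero {k} k≢0 eq = [ (λ k≡0 → contradiction k≡0 k≢0) , (λ i≡0 → i≡0) ]′ (ℤ.i*j≡0⇒i≡0∨j≡0 k eq)

e₀ : V
e₀ = ⟨ 1ℤ , 0ℤ , 0ℤ , 0ℤ ⟩

e₀-· : ∀ x → e₀ · x ≡ V.a x
e₀-· ⟨ a , b , c , d ⟩ = lemma a b c d
  where
  lemma : ∀ a b c d → 1ℤ * a + 0ℤ * b + 0ℤ * c + 0ℤ * d ≡ a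
  lemma = solve-∀

zero? : ∀ i → Dec (i ≡ 0ℤ)
zero? (+ zero)  = yes refl
zero? (+ suc _) = no λ ()
zero? -[1+ _ ]  = no λ ()

record Matrix : Set where
  constructor rows
  field r₀ r₁ r₂ r₃ : V

infixl 7 _∙_

_∙_ : Matrix → V → V
rows f g h k ∙ x = ⟨ f · x , g · x , h · x , k · x ⟩

identity : Matrix
identity = rows e₀ ⟨ 0ℤ , 1ℤ , 0ℤ , 0ℤ ⟩ ⟨ 0ℤ , 0ℤ , 1ℤ , 0ℤ ⟩ ⟨ 0ℤ , 0ℤ , 0ℤ , 1ℤ ⟩

-- Three times the reflection in v, for v of norm 3.
reflect : V → V → V
reflect v y = lin (+ 3) y (- (+ 2 * (v · y))) v

norm-reflect : ∀ v y → norm v ≡ + 3 → norm (reflect v y) ≡ + 9 * norm y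
norm-reflect v@(⟨ a , b , c , d ⟩) y@(⟨ e , f , g , h ⟩) eq =
  trans (expand a b c d e f g h (v · y)) (simplify (norm y) (v · y) eq)
  where
  expand : ∀ a b c d e f g h t →
    (+ 3 * e + - (+ 2 * t) * a) * (+ 3 * e + - (+ 2 * t) * a) + (+ 3 * f + - (+ 2 * t) * b) * (+ 3 * f + - (+ 2 * t) * b)
    + (+ 3 * g + - (+ 2 * t) * c) * (+ 3 * g + - (+ 2 * t) * c) + (+ 3 * h + - (+ 2 * t) * d) * (+ 3 * h + - (+ 2 * t) * d)
    ≡ + 9 * (e * e + f * f + g * g + h * h) - + 12 * t * (a * e + b * f + c * g + d * h)
      + + 4 * t * t * (a * a + b * b + c * c + d * d)
  expand = solve-∀
  simplify : ∀ n t {m} → m ≡ + 3 → + 9 * n - + 12 * t * t + + 4 * t * t * m ≡ + 9 * n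
  simplify n t refl = lemma n t
    where
    lemma : ∀ n t → + 9 * n - + 12 * t * t + + 4 * t * t * + 3 ≡ + 9 * n
    lemma = solve-∀

-- Composition is carried out on rows, so that a word of reflections has explicit numerical
-- coefficients; the search needs these to form its linear conditions.
reflectRows : V → Matrix → Matrix
reflectRows v@(⟨ a , b , c , d ⟩) (rows f g h k) = rows (row f a) (row g b) (row h c) (row k d)
  where
  total = lin 1ℤ (lin a f b g) 1ℤ (lin c h d k)
  row : V → ℤ → V
  row f a = lin (+ 3) f (- (+ 2 * a)) total

reflectRows-∙ : ∀ v A x → reflectRows v A ∙ x ≡ reflect v (A ∙ x)
reflectRows-∙ v@(⟨ a , b , c , d ⟩) A@(rows f g h k) x = ⟨⟩-cong (row f a) (row g b) (row h c) (row k d)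
  where
  total = lin 1ℤ (lin a f b g) 1ℤ (lin c h d k)
  regroup : ∀ p q r s → 1ℤ * (p + q) + 1ℤ * (r + s) ≡ p + q + r + s
  regroup = solve-∀
  total-· : total · x ≡ v · (A ∙ x)
  total-· = trans (lin-· 1ℤ (lin a f b g) 1ℤ (lin c h d k) x)
    (trans (cong₂ (λ s t → 1ℤ * s + 1ℤ * t) (lin-· a f b g x) (lin-· c h d k x))
      (regroup (a * (f · x)) (b * (g · x)) (c * (h · x)) (d * (k · x))))
  swap : ∀ y t a → + 3 * y + - (+ 2 * a) * t ≡ + 3 * y + - (+ 2 * t) * a
  swap = solve-∀
  row : ∀ f a → lin (+ 3) f (- (+ 2 * a)) total · x ≡ + 3 * (f · x) + - (+ 2 * (v · (A ∙ x))) * a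
  row f a = trans (lin-· (+ 3) f (- (+ 2 * a)) total x)
    (trans (cong (λ t → + 3 * (f · x) + - (+ 2 * a) * t) total-·) (swap (f · x) (v · (A ∙ x)) a))

-- A rational isometry stored with its denominator cleared. Integrality of the image of x becomes
-- divisibility of `matrix ∙ x` by `den`.
record Move : Set where
  field
    matrix   : Matrix
    den      : ℕ
    .{{den≢0}} : ℕ.NonZero den
    isometry : ∀ x → norm (matrix ∙ x) ≡ + den * + den * norm x

Norm3 : Set
Norm3 = Σ V λ v → norm v ≡ + 3

prepend : Norm3 → Move → Move
prepend (v , v≡) m = record
  { matrix   = reflectRows v matrix
  ; den      = 3 ℕ.* den
  ; den≢0    = ℕ.m*n≢0 3 den
  ; isometry = λ x → trans (cong norm (reflectRows-∙ v matrix x))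
      (trans (norm-reflect v (matrix ∙ x) v≡)
        (trans (cong (+ 9 *_) (isometry x))
          (trans (regroup (+ den) (norm x)) (cong (λ k → k * k * norm x) (sym (ℤ.pos-* 3 den))))))
  }
  where
  open Move m
  regroup : ∀ d n → + 9 * (d * d * n) ≡ + 3 * d * (+ 3 * d) * n
  regroup = solve-∀

stay : Move
stay = record { matrix = identity ; den = 1 ; isometry = λ { ⟨ a , b , c , d ⟩ → lemma a b c d } }
  where
  lemma : ∀ a b c d →
    (1ℤ * a + 0ℤ * b + 0ℤ * c + 0ℤ * d) * (1ℤ * a + 0ℤ * b + 0ℤ * c + 0ℤ * d)
    + (0ℤ * a + 1ℤ * b + 0ℤ * c + 0ℤ * d) * (0ℤ * a + 1ℤ * b + 0ℤ * c + 0ℤ * d)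
    + (0ℤ * a + 0ℤ * b + 1ℤ * c + 0ℤ * d) * (0ℤ * a + 0ℤ * b + 1ℤ * c + 0ℤ * d)
    + (0ℤ * a + 0ℤ * b + 0ℤ * c + 1ℤ * d) * (0ℤ * a + 0ℤ * b + 0ℤ * c + 1ℤ * d)
    ≡ + 1 * + 1 * (a * a + b * b + c * c + d * d)
  lemma = solve-∀

-- One vector from each pair ±v, because v and -v define the same reflection: 16 out of the 32
-- vectors of norm 3.
reflections : List Norm3
reflections = concatMap signs (true ∷ false ∷ [])
  where
  signs : Bool → List Norm3
  signs s = concatMap (λ t → (⟨ 0ℤ , 1ℤ , i s , i t ⟩ , ok s t) ∷ (⟨ 1ℤ , 0ℤ , i s , i t ⟩ , ok s t)
      ∷ (⟨ 1ℤ , i s , 0ℤ , i t ⟩ , ok′ s t) ∷ (⟨ 1ℤ , i s , i t , 0ℤ ⟩ , ok″ s t) ∷ []) (true ∷ false ∷ [])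
    where
    i : Bool → ℤ
    i true  = 1ℤ
    i false = -1ℤ
    ok : ∀ s t → + 1 + i s * i s + i t * i t ≡ + 3
    ok false false = refl
    ok false true  = refl
    ok true  false = refl
    ok true  true  = refl
    ok′ : ∀ s t → + 1 + i s * i s + 0ℤ + i t * i t ≡ + 3
    ok′ false false = refl
    ok′ false true  = refl
    ok′ true  false = refl
    ok′ true  true  = refl
    ok″ : ∀ s t → + 1 + i s * i s + i t * i t + 0ℤ ≡ + 3
    ok″ false false = refl
    ok″ false true  = refl
    ok″ true  false = refl
    ok″ true  true  = refl

-- Each single reflection comes with the words of length two that start with it.
moves : List (Move × List Move)
moves = map (λ v → prepend v stay , map (λ w → prepend w (prepend v stay)) reflections) reflections

-- Searching for a successful move

-- Fraction-free Gaussian elimination: the first p with f · p ≠ 0 is the pivot, and the result spans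
-- the kernel of f in the span with one vector fewer. `nothing` means that f vanishes on the whole
-- list.
eliminate : V → List V → Maybe (List V)
combine : V → V → ℤ → List V → List V

combine f p c []       = []
combine f p c (q ∷ qs) = lin c q (- (f · q)) p ∷ combine f p c qs

eliminate f []       = nothing
eliminate f (p ∷ ps) with zero? (f · p)
... | yes _ = Maybe.map (p ∷_) (eliminate f ps)
... | no _  = just (combine f p (f · p) ps)

Kills : V → List V → Set
Kills g = All (λ p → g · p ≡ 0ℤ)

-- x lies in the rational span of ps, expressed through the annihilator.
InSpan : V → List V → Set
InSpan x ps = ∀ g → Kills g ps → g · x ≡ 0ℤ

combine-kills : ∀ f p g qs → Kills g (combine f p (f · p) qs) →
                Kills (lin (f · p) g (- (g · p)) f) qs
combine-kills f p g []       []       = []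
combine-kills f p g (q ∷ qs) (z ∷ zs) = trans (lin-· (f · p) g (- (g · p)) f q)
  (trans (swap (f · p) (g · q) (g · p) (f · q)) (trans (sym (·-lin g (f · p) q (- (f · q)) p)) z)) ∷ combine-kills f p g qs zs
  where
  swap : ∀ a b c d → a * b + - c * d ≡ a * b + - d * c
  swap = solve-∀

-- For the pivot p, the form (f · p) g - (g · p) f kills p, and its value at a later q is that of g
-- at the vector replacing q. So annihilators of the new list are those of the old one up to
-- multiples of f.
eliminate-kills : ∀ f ps {qs} → eliminate f ps ≡ just qs → ∀ g → Kills g qs →
                  ∃₂ λ k l → k ≢ 0ℤ × Kills (lin k g l f) ps
eliminate-kills f (p ∷ ps) eq g kills with zero? (f · p)
eliminate-kills f (p ∷ ps) refl g kills | no f·p≢0 = f · p , - (g · p) , f·p≢0 ,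
  trans (lin-· (f · p) g (- (g · p)) f p) (vanish (f · p) (g · p)) ∷ combine-kills f p g ps kills
  where
  vanish : ∀ a b → a * b + - b * a ≡ 0ℤ
  vanish = solve-∀
... | yes f·p≡0 with eliminate f ps in eq′
eliminate-kills f (p ∷ ps) refl g (z ∷ kills) | yes f·p≡0 | just _ with eliminate-kills f ps eq′ g kills
... | k , l , k≢0 , rest = k , l , k≢0 , trans (lin-· k g l f p) (vanish k l z f·p≡0) ∷ rest
  where
  vanish : ∀ k l {i j} → i ≡ 0ℤ → j ≡ 0ℤ → k * i + l * j ≡ 0ℤ
  vanish k l refl refl = cong₂ _+_ (ℤ.*-zeroʳ k) (ℤ.*-zeroʳ l)

eliminate-span : ∀ f ps {qs x} → eliminate f ps ≡ just qs → f · x ≡ 0ℤ → InSpan x ps → InSpan x qs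
eliminate-span f ps {x = x} eq f·x≡0 span g kills with eliminate-kills f ps eq g kills
... | k , l , k≢0 , kills′ = cancel-zero k≢0 (conclude k l (trans (sym (lin-· k g l f x)) (span (lin k g l f) kills′)) f·x≡0)
  where
  conclude : ∀ k l {i j} → k * i + l * j ≡ 0ℤ → j ≡ 0ℤ → k * i ≡ 0ℤ
  conclude k l {i} eq refl = trans (drop k l i) eq
    where
    drop : ∀ k l i → k * i ≡ k * i + l * 0ℤ
    drop = solve-∀

-- Both signs of r are excluded because the summands over ℕ will be absolute values of the
-- coordinates.
Avoids : ℤ → V → Set
Avoids r ⟨ a , b , c , d ⟩ = (a ≢ r × a ≢ - r) × (b ≢ r × b ≢ - r) × (c ≢ r × c ≢ - r) × (d ≢ r × d ≢ - r)

Parallel : V → V → Set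
Parallel ⟨ s , t , u , v ⟩ ⟨ a , b , c , d ⟩ = s * b ≡ t * a × s * c ≡ u * a × s * d ≡ v * a

-- The ways in which a search can end. On a ray, the condition on s makes every prime p > 3 that divides x₀
-- divide x. The pair (5, 79) is a genuine exception. The plane {(a, a, a, d)} with d ≡ 4a mod 9 survives
-- every bounded number of reflections.
data Outcome (x : V) : Set where
  good : ∀ y → norm y ≡ norm x → Avoids (V.a x) y → Outcome x
  ray : ∀ s → ∣ V.a s ∣ ℕ.∣ 216 → Parallel s x → Outcome x
  exceptional : ∀ k s → x ≡ scale k s → ∣ V.a s ∣ ≡ 5 → norm s ≡ + 79 → Outcome x
  plane₁ : V.b x ≡ V.a x → V.c x ≡ V.a x → + 9 ∣ℤ V.d x - + 4 * V.a x → Outcome x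
  plane₂ : V.b x ≡ V.a x → V.d x ≡ V.a x → + 9 ∣ℤ V.c x - + 4 * V.a x → Outcome x
  plane₃ : V.c x ≡ V.a x → V.d x ≡ V.a x → + 9 ∣ℤ V.b x - + 4 * V.a x → Outcome x

-- Heuristics whose results are validated where they are used.

private
  gcd-fuel : ℕ → ℕ → ℕ → ℕ
  gcd-fuel _       a zero    = a
  gcd-fuel zero    a (suc _) = a
  gcd-fuel (suc n) a (suc b) = gcd-fuel n (suc b) (a ℕ.% suc b)

  divide : ℕ → ℤ → ℤ
  divide zero    i = i
  divide (suc g) i = i /ℕ suc g

  divideV : ℕ → V → V
  divideV g ⟨ a , b , c , d ⟩ = ⟨ divide g a , divide g b , divide g c , divide g d ⟩

primitivePart : V → V
primitivePart x@(⟨ a , b , c , d ⟩) =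
  divideV (gcd-fuel 60 (gcd-fuel 60 (∣ a ∣) (∣ b ∣)) (gcd-fuel 60 (∣ c ∣) (∣ d ∣))) x

private
  egcd-step : ℕ → ℤ × ℤ → ℤ × ℤ
  egcd-step q (u , v) = v , u - v * + q

  egcd : ℕ → ℕ → ℕ → ℤ × ℤ
  egcd _       a zero    = 1ℤ , 0ℤ
  egcd zero    a (suc _) = 1ℤ , 0ℤ
  egcd (suc n) a (suc b) = egcd-step (a ℕ./ suc b) (egcd n (suc b) (a ℕ.% suc b))

  signed : ℤ → ℤ → ℤ
  signed (+ _)    k = k
  signed -[1+ _ ] k = - k

  bezout′ : ℤ × ℤ → ℤ × ℤ → ℤ × ℤ → V → V
  bezout′ (p , q) (r , s) (u , v) ⟨ a , b , c , d ⟩ =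
    ⟨ signed a (u * p) , signed b (u * q) , signed c (v * r) , signed d (v * s) ⟩

bezout : V → V
bezout x@(⟨ a , b , c , d ⟩) = bezout′ (egcd 60 (∣ a ∣) (∣ b ∣)) (egcd 60 (∣ c ∣) (∣ d ∣))
  (egcd 60 (gcd-fuel 60 (∣ a ∣) (∣ b ∣)) (gcd-fuel 60 (∣ c ∣) (∣ d ∣))) x

-- Backtracking over non-increasing entries at most b; the first test gives up when the remaining
-- squares cannot reach n. A list may stop at its first 0, and `toV` pads it.
sumOfSquares : ℕ → ℕ → ℕ → ℕ → Maybe (List ℕ)
sumOfSquares avoid zero    b zero    = just []
sumOfSquares avoid zero    b (suc _) = nothing
sumOfSquares avoid (suc k) zero n    = if n ℕ.≡ᵇ 0 then just (0 ∷ []) else nothing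
sumOfSquares avoid (suc k) b@(suc b′) n =
  if suc k ℕ.* (b ℕ.* b) ℕ.<ᵇ n then nothing else
  if (b ℕ.≡ᵇ avoid) ∨ (n ℕ.<ᵇ b ℕ.* b) then sumOfSquares avoid (suc k) b′ n
  else (Maybe.map (b ∷_) (sumOfSquares avoid k b (n ℕ.∸ b ℕ.* b)) <∣> sumOfSquares avoid (suc k) b′ n)

toV : List ℕ → V
toV (a ∷ b ∷ c ∷ d ∷ []) = ⟨ + a , + b , + c , + d ⟩
toV (a ∷ b ∷ c ∷ [])     = ⟨ + a , + b , + c , 0ℤ ⟩
toV (a ∷ b ∷ [])         = ⟨ + a , + b , 0ℤ , 0ℤ ⟩
toV (a ∷ [])             = ⟨ + a , 0ℤ , 0ℤ , 0ℤ ⟩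
toV _                    = ⟨ 0ℤ , 0ℤ , 0ℤ , 0ℤ ⟩

representation : V → Maybe V
representation s = Maybe.map toV (sumOfSquares (∣ V.a s ∣) 4 100 (∣ norm s ∣))

avoids? : ∀ r y → Dec (Avoids r y)
avoids? r ⟨ a , b , c , d ⟩ = differ a ×-dec differ b ×-dec differ c ×-dec differ d
  where
  differ : ∀ i → Dec (i ≢ r × i ≢ - r)
  differ i = ¬? (i ≟ r) ×-dec ¬? (i ≟ - r)

avoids-scale : ∀ {k r y} → k ≢ 0ℤ → Avoids r y → Avoids (k * r) (scale k y)
avoids-scale {k} {r} {⟨ a , b , c , d ⟩} k≢0 (p , q , s , t) = both p , both q , both s , both t
  where
  both : ∀ {i} → i ≢ r × i ≢ - r → k * i ≢ k * r × k * i ≢ - (k * r)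
  both {i} (≢r , ≢-r) = ≢r ∘ cancel i r , ≢-r ∘ cancel i (- r) ∘ (λ eq → trans eq (ℤ.neg-distribʳ-* k r))
    where
    cancel : ∀ i j → k * i ≡ k * j → i ≡ j
    cancel i j = ℤ.*-cancelˡ-≡ k i j {{≢-nonZero k≢0}}

mod-nine : ∀ u → + 3 ∣ℤ u → (+ 9 ∣ℤ u) ⊎ (+ 9 ∣ℤ u - + 3) ⊎ (+ 9 ∣ℤ u - + 6)
mod-nine u (divides q u≡) = by-remainder (q %ℕ 3) (n%ℕd<d q 3) (trans u≡ (cong (_* + 3) (a≡a%ℕn+[a/ℕn]*n q 3)))
  where
  k = q /ℕ 3
  zeroth : ∀ k → (+ 0 + k * + 3) * + 3 ≡ k * + 9
  zeroth = solve-∀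
  first : ∀ k → (+ 1 + k * + 3) * + 3 - + 3 ≡ k * + 9
  first = solve-∀
  second : ∀ k → (+ 2 + k * + 3) * + 3 - + 6 ≡ k * + 9
  second = solve-∀
  by-remainder : ∀ r → r ℕ.< 3 → u ≡ (+ r + k * + 3) * + 3 → (+ 9 ∣ℤ u) ⊎ (+ 9 ∣ℤ u - + 3) ⊎ (+ 9 ∣ℤ u - + 6)
  by-remainder 0 _ eq = inj₁ (divides k (trans eq (zeroth k)))
  by-remainder 1 _ eq = inj₂ (inj₁ (divides k (trans (cong (_- + 3) eq) (first k))))
  by-remainder 2 _ eq = inj₂ (inj₂ (divides k (trans (cong (_- + 6) eq) (second k))))
  by-remainder (suc (suc (suc _))) (s≤s (s≤s (s≤s ()))) _

-- The search at a fixed vector, with the proof of its soundness built in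

module Search (x : V) (x₀≢0 : V.a x ≢ 0ℤ) where

  Congruent : ℕ → V → Set
  Congruent N r = + N ∣ᵥ lin 1ℤ x -1ℤ r

  congruent-· : ∀ {N r} f → Congruent N r → f · x ≡ 0ℤ → + N ∣ℤ f · r
  congruent-· {N} {r} f cong-r f·x≡0 = subst (+ N ∣ℤ_) (eliminate-x (·-lin f 1ℤ x -1ℤ r) f·x≡0) (∣m⇒∣-m (∣-· f cong-r))
    where
    eliminate-x : ∀ {i j k} → i ≡ 1ℤ * j + -1ℤ * k → j ≡ 0ℤ → - i ≡ k
    eliminate-x {k = k} refl refl = lemma k
      where
      lemma : ∀ k → - (1ℤ * 0ℤ + -1ℤ * k) ≡ k
      lemma = solve-∀

  module Leaf (s : V) where

    from-form : ∀ s₀ s₁ x₀ x₁ → (- s₁) * x₀ + s₀ * x₁ ≡ 0ℤ → s₀ * x₁ ≡ s₁ * x₀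
    from-form s₀ s₁ x₀ x₁ eq = ℤ.i-j≡0⇒i≡j (s₀ * x₁) (s₁ * x₀) (trans (lemma s₀ s₁ x₀ x₁) eq)
      where
      lemma : ∀ s₀ s₁ x₀ x₁ → s₀ * x₁ - s₁ * x₀ ≡ (- s₁) * x₀ + s₀ * x₁
      lemma = solve-∀

    g₁ g₂ g₃ : V
    g₁ = ⟨ - V.b s , V.a s , 0ℤ , 0ℤ ⟩
    g₂ = ⟨ - V.c s , 0ℤ , V.a s , 0ℤ ⟩
    g₃ = ⟨ - V.d s , 0ℤ , 0ℤ , V.a s ⟩

    parallel : ∀ p → g₁ · p ≡ 0ℤ → g₂ · p ≡ 0ℤ → g₃ · p ≡ 0ℤ → InSpan x (p ∷ []) → Parallel s x
    parallel p z₁ z₂ z₃ span =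
        from-form (V.a s) (V.b s) (V.a x) (V.b x) (trans (i₁ (V.a s) (V.b s) (V.a x) (V.b x) (V.c x) (V.d x)) (span g₁ (z₁ ∷ [])))
      , from-form (V.a s) (V.c s) (V.a x) (V.c x) (trans (i₂ (V.a s) (V.c s) (V.a x) (V.b x) (V.c x) (V.d x)) (span g₂ (z₂ ∷ [])))
      , from-form (V.a s) (V.d s) (V.a x) (V.d x) (trans (i₃ (V.a s) (V.d s) (V.a x) (V.b x) (V.c x) (V.d x)) (span g₃ (z₃ ∷ [])))
      where
      i₁ : ∀ s t a b c d → (- t) * a + s * b ≡ (- t) * a + s * b + 0ℤ * c + 0ℤ * d
      i₁ = solve-∀
      i₂ : ∀ s t a b c d → (- t) * a + s * c ≡ (- t) * a + 0ℤ * b + s * c + 0ℤ * d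
      i₂ = solve-∀
      i₃ : ∀ s t a b c d → (- t) * a + s * d ≡ (- t) * a + 0ℤ * b + 0ℤ * c + s * d
      i₃ = solve-∀

    -- Parallelism gives s₀ (c · x) = x₀ (c · s) = x₀. The integer c · x is therefore the factor,
    -- and s₀ ≠ 0 can be cancelled in the other coordinates.
    multiple : ∀ c → c · s ≡ 1ℤ → Parallel s x → x ≡ scale (c · x) s
    multiple ⟨ p , q , u , v ⟩ eq (e₁ , e₂ , e₃) = ⟨⟩-cong
        (trans first (ℤ.*-comm (V.a s) k))
        (component (V.b x) (V.b s) e₁) (component (V.c x) (V.c s) e₂) (component (V.d x) (V.d s) e₃)
      where
      k = ⟨ p , q , u , v ⟩ · x
      expand : ∀ s₀ p q u v a b c d → s₀ * (p * a + q * b + u * c + v * d) ≡ p * (s₀ * a) + q * (s₀ * b) + u * (s₀ * c) + v * (s₀ * d)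
      expand = solve-∀
      collect : ∀ a p q u v s₀ s₁ s₂ s₃ → p * (s₀ * a) + q * (s₁ * a) + u * (s₂ * a) + v * (s₃ * a) ≡ a * (p * s₀ + q * s₁ + u * s₂ + v * s₃)
      collect = solve-∀
      substitute : ∀ p q u v {t a b c a′ b′ c′} → a ≡ a′ → b ≡ b′ → c ≡ c′ → p * t + q * a + u * b + v * c ≡ p * t + q * a′ + u * b′ + v * c′
      substitute _ _ _ _ refl refl refl = refl
      first : V.a x ≡ V.a s * k
      first = sym (trans (expand (V.a s) p q u v (V.a x) (V.b x) (V.c x) (V.d x))
        (trans (substitute p q u v e₁ e₂ e₃)
        (trans (collect (V.a x) p q u v (V.a s) (V.b s) (V.c s) (V.d s))
        (trans (cong (V.a x *_) eq) (ℤ.*-identityʳ (V.a x))))))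
      s₀≢0 : V.a s ≢ 0ℤ
      s₀≢0 s₀≡0 = x₀≢0 (trans first (trans (cong (_* k) s₀≡0) (ℤ.*-zeroˡ k)))
      component : ∀ x₁ s₁ → V.a s * x₁ ≡ s₁ * V.a x → x₁ ≡ k * s₁
      component x₁ s₁ eq₁ = ℤ.*-cancelˡ-≡ (V.a s) x₁ (k * s₁) {{≢-nonZero s₀≢0}}
        (trans eq₁ (trans (cong (s₁ *_) first) (regroup s₁ (V.a s) k)))
        where
        regroup : ∀ s₁ s₀ k → s₁ * (s₀ * k) ≡ s₀ * (k * s₁)
        regroup = solve-∀

    avoid : ∀ k y → x ≡ scale k s → norm y ≡ norm s → Avoids (V.a s) y → Outcome x
    avoid k y refl eq av = good (scale k y)
      (trans (norm-scale k y) (trans (cong (k * k *_) eq) (sym (norm-scale k s))))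
      (avoids-scale k≢0 av)
      where
      k≢0 : k ≢ 0ℤ
      k≢0 k≡0 = x₀≢0 (trans (cong (_* V.a s) k≡0) (ℤ.*-zeroˡ (V.a s)))

    primitive-leaf : Maybe V → Maybe ((∃ λ k → x ≡ scale k s) → Outcome x)
    primitive-leaf y with norm s ≟ + 79 | ∣ V.a s ∣ ℕ.≟ 5
    primitive-leaf y        | yes n≡79 | yes s≡5 = just λ (k , eq) → exceptional k s eq s≡5 n≡79
    primitive-leaf nothing  | _ | _ = nothing
    primitive-leaf (just y) | _ | _ with norm y ≟ norm s | avoids? (V.a s) y
    ... | yes n≡ | yes av = just λ (k , eq) → avoid k y eq n≡ av
    ... | _      | _      = nothing

    leaf : ∀ p → Maybe (InSpan x (p ∷ []) → Outcome x)
    leaf p with zero? (g₁ · p) | zero? (g₂ · p) | zero? (g₃ · p)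
    -- Here 216 = 6³. Such rays are left to primitivity at p, because the norm of s may have no
    -- representation that avoids s₀, as for s = (3,2,1,0).
    ... | yes z₁ | yes z₂ | yes z₃ with ∣ V.a s ∣ ℕ.∣? 216
    ...   | yes smooth = just λ span → ray s smooth (parallel p z₁ z₂ z₃ span)
    ...   | no _ with bezout s · s ≟ 1ℤ
    ...     | yes eq = Maybe.map (λ f span → f (bezout s · x , multiple (bezout s) eq (parallel p z₁ z₂ z₃ span)))
                         (primitive-leaf (representation s))
    ...     | no _ = nothing
    leaf p | _ | _ | _ = nothing

  strip : V → V
  strip f with + 3 ∣ᵥ? f
  ... | no _    = f
  ... | yes 3∣f = proj₁ (∣ᵥ-quotient 3∣f)

  strip-· : ∀ f → f · x ≡ 0ℤ → strip f · x ≡ 0ℤ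
  strip-· f eq with + 3 ∣ᵥ? f
  ... | no _    = eq
  ... | yes 3∣f = third (∣ᵥ-quotient 3∣f)
    where
    third : (q : ∃ λ g → f ≡ scale (+ 3) g) → proj₁ q · x ≡ 0ℤ
    third (g , refl) = cancel-zero {+ 3} (λ ()) (trans (sym (scale-· (+ 3) g x)) eq)

  -- A form vanishing at x as soon as row · x ≡ k x₀; dividing by 3 sharpens its congruence conditions.
  obstruction : V → ℤ → V
  obstruction row k = strip (strip (lin 1ℤ row (- k) e₀))

  obstruction-vanishes : ∀ row k → row · x ≡ k * V.a x → obstruction row k · x ≡ 0ℤ
  obstruction-vanishes row k eq = strip-· (strip form) (strip-· form form-vanishes)
    where
    form = lin 1ℤ row (- k) e₀
    vanish : ∀ k a {i j} → i ≡ k * a → j ≡ a → 1ℤ * i + - k * j ≡ 0ℤ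
    vanish k a refl refl = lemma k a
      where
      lemma : ∀ k a → 1ℤ * (k * a) + - k * a ≡ 0ℤ
      lemma = solve-∀
    form-vanishes : form · x ≡ 0ℤ
    form-vanishes = trans (lin-· 1ℤ row (- k) e₀ x) (vanish k (V.a x) eq (e₀-· x))

  Attempt : List V → Set
  Attempt fs = All (λ f → f · x ≢ 0ℤ) fs → Outcome x

  coordinateForms : (V → ℤ → V) → Move → List V
  coordinateForms o m = o r₀ k ∷ o r₀ (- k) ∷ o r₁ k ∷ o r₁ (- k) ∷ o r₂ k ∷ o r₂ (- k) ∷ o r₃ k ∷ o r₃ (- k) ∷ []
    where
    open Matrix (Move.matrix m)
    k = + Move.den m

  module Image (o : V → ℤ → V) (o-vanishes : ∀ row k → row · x ≡ k * V.a x → o row k · x ≡ 0ℤ)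
               (m : Move) (y : V) (y-eq : Move.matrix m ∙ x ≡ scale (+ Move.den m) y) where

    open Move m
    open Matrix matrix

    norm-y : norm y ≡ norm x
    norm-y = norm-cancel (+ den) y (norm x) (trans (sym (norm-scale (+ den) y)) (trans (cong norm (sym y-eq)) (isometry x)))
      where
      norm-cancel : ∀ k y n .{{_ : NonZero k}} → k * k * norm y ≡ k * k * n → norm y ≡ n
      norm-cancel k y n eq = ℤ.*-cancelˡ-≡ k (norm y) n (ℤ.*-cancelˡ-≡ k (k * norm y) (k * n)
        (trans (sym (ℤ.*-assoc k k (norm y))) (trans eq (ℤ.*-assoc k k n))))

    coordinate : ∀ row i → row · x ≡ + den * i → o row (+ den) · x ≢ 0ℤ → o row (- + den) · x ≢ 0ℤ →
                 i ≢ V.a x × i ≢ - V.a x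
    coordinate row i eq o⁺ o⁻ =
      (λ i≡ → o⁺ (o-vanishes row (+ den) (trans eq (cong (+ den *_) i≡)))) ,
      (λ i≡ → o⁻ (o-vanishes row (- + den) (trans eq (trans (cong (+ den *_) i≡) (move-sign (+ den) (V.a x))))))
      where
      move-sign : ∀ k a → k * - a ≡ - k * a
      move-sign = solve-∀

    attempt : Attempt (coordinateForms o m)
    attempt (o₁ ∷ o₂ ∷ o₃ ∷ o₄ ∷ o₅ ∷ o₆ ∷ o₇ ∷ o₈ ∷ []) = good y norm-y
      ( coordinate r₀ (V.a y) (cong V.a y-eq) o₁ o₂ , coordinate r₁ (V.b y) (cong V.b y-eq) o₃ o₄
      , coordinate r₂ (V.c y) (cong V.c y-eq) o₅ o₆ , coordinate r₃ (V.d y) (cong V.d y-eq) o₇ o₈)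

  obstructions : Move → List V
  obstructions = coordinateForms obstruction

  attempt : ∀ m → + Move.den m ∣ᵥ Move.matrix m ∙ x → Attempt (obstructions m)
  attempt m den∣ = from-quotient (∣ᵥ-quotient den∣)
    where
    from-quotient : (∃ λ y → Move.matrix m ∙ x ≡ scale (+ Move.den m) y) → Attempt (obstructions m)
    from-quotient (y , y-eq) = Image.attempt obstruction obstruction-vanishes m y y-eq

  congruent-∣ : ∀ {N r m} f → m ∣ℤ + N → Congruent N r → m ∣ℤ f · r → m ∣ℤ f · x
  congruent-∣ {N} {r} {m} f m∣N cong-r m∣f·r = subst (m ∣ℤ_) (add-r (·-lin f 1ℤ x -1ℤ r))
    (∣m∣n⇒∣m+n (∣-trans m∣N (∣-· f cong-r)) m∣f·r)
    where
    add-r : ∀ {i j k} → i ≡ 1ℤ * j + -1ℤ * k → i + k ≡ j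
    add-r {j = j} {k} refl = lemma j k
      where
      lemma : ∀ j k → 1ℤ * j + -1ℤ * k + k ≡ j
      lemma = solve-∀

  -- Divisibility is tested at the representative r and holds on its whole class as soon as `den`
  -- divides N. Words of denominator 9 therefore become available only at modulus 9.
  applicable? : ∀ N r m → Maybe (Congruent N r → + Move.den m ∣ᵥ Move.matrix m ∙ x)
  applicable? N r m with + Move.den m ∣ℤ? + N | + Move.den m ∣ᵥ? Move.matrix m ∙ r
  ... | yes den∣N | yes (p , q , s , t) = just λ c →
    congruent-∣ r₀ den∣N c p , congruent-∣ r₁ den∣N c q , congruent-∣ r₂ den∣N c s , congruent-∣ r₃ den∣N c t
    where open Matrix (Move.matrix m)
  ... | _ | _ = nothing

  attempts : ∀ N r → List Move → List (List V)
  attempts N r []       = []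
  attempts N r (m ∷ ms) with applicable? N r m
  ... | just _  = obstructions m ∷ attempts N r ms
  ... | nothing = attempts N r ms

  attempts-valid : ∀ {N r} ms → Congruent N r → All Attempt (attempts N r ms)
  attempts-valid []       c = []
  attempts-valid {N} {r} (m ∷ ms) c with applicable? N r m
  ... | just den∣ = attempt m (den∣ c) ∷ attempts-valid ms c
  ... | nothing   = attempts-valid ms c

  allAttempts : ∀ N r → List (Move × List Move) → List (List V)
  allAttempts N r []               = []
  allAttempts N r ((m , ms) ∷ mms) with applicable? N r m
  ... | just _  = obstructions m ∷ attempts N r ms ++ allAttempts N r mms
  ... | nothing = allAttempts N r mms

  allAttempts-valid : ∀ {N r} mms → Congruent N r → All Attempt (allAttempts N r mms)
  allAttempts-valid []               c = []
  allAttempts-valid {N} {r} ((m , ms) ∷ mms) c with applicable? N r m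
  ... | just den∣ = attempt m (den∣ c) ∷ All.++⁺ (attempts-valid ms c) (allAttempts-valid mms c)
  ... | nothing   = allAttempts-valid mms c

  data Branch (N : ℕ) (r : V) (ps : List V) (f : V) : Set where
    closed   : (Congruent N r → InSpan x ps → f · x ≢ 0ℤ) → Branch N r ps f
    narrowed : ∀ qs → eliminate f ps ≡ just qs → Branch N r ps f

  kills? : ∀ g ps → Maybe (Kills g ps)
  kills? g []       = just []
  kills? g (p ∷ ps) with zero? (g · p)
  ... | yes z = Maybe.map (z ∷_) (kills? g ps)
  ... | no _  = nothing

  -- A form is refuted either by its value at r modulo N or because its zeros in the span have x₀ =
  -- 0. If it vanishes on all of `ps`, assuming f · x = 0 gains nothing and the move is given up.
  branch : ∀ N r ps f → Maybe (Branch N r ps f)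
  branch N r ps f with + N ∣ℤ? f · r
  ... | no N∤ = just (closed λ c _ f·x≡0 → N∤ (congruent-· f c f·x≡0))
  ... | yes _ with eliminate f ps in eq
  ...   | nothing = nothing
  ...   | just qs with kills? e₀ qs
  ...     | just kills = just (closed λ _ span f·x≡0 →
              x₀≢0 (trans (sym (e₀-· x)) (eliminate-span f ps eq f·x≡0 span e₀ kills)))
  ...     | nothing = just (narrowed qs eq)

  branches : ∀ N r ps fs → Maybe (All (Branch N r ps) fs)
  branches N r ps []       = just []
  branches N r ps (f ∷ fs) with branch N r ps f
  ... | nothing = nothing
  ... | just b  = Maybe.map (b ∷_) (branches N r ps fs)

  -- ms lists, for each applicable move, the forms one of which must vanish at x if the move does not succeed.
  record State (N : ℕ) (r : V) (Γ ps : List V) (ms : List (List V)) : Set where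
    constructor state
    field
      congruent : Congruent N r
      vanishing : All (λ f → f · x ≡ 0ℤ) Γ
      span      : InSpan x ps
      valid     : All Attempt ms

  decide : ∀ {fs} → Attempt fs → All (λ f → f · x ≡ 0ℤ → Outcome x) fs → Outcome x
  decide {[]}     done []       = done []
  decide {f ∷ fs} done (b ∷ bs) with zero? (f · x)
  ... | yes z  = b z
  ... | no f≢0 = decide (λ rest → done (f≢0 ∷ rest)) bs

  -- One class modulo 3 is three classes modulo 9, all of which have to be covered.
  refine : ∀ {O : Set} a r → (∀ r′ → Maybe (+ 9 ∣ℤ 1ℤ * a + -1ℤ * r′ → O)) → Maybe (+ 3 ∣ℤ 1ℤ * a + -1ℤ * r → O)
  refine {O} a r f = merge (f r) (f (r + + 3)) (f (r + + 6))
    where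
    u = 1ℤ * a + -1ℤ * r
    shifted : ∀ k → + 9 ∣ℤ u - k → + 9 ∣ℤ 1ℤ * a + -1ℤ * (r + k)
    shifted k = subst (+ 9 ∣ℤ_) (rearrange a r k)
      where
      rearrange : ∀ a r k → 1ℤ * a + -1ℤ * r - k ≡ 1ℤ * a + -1ℤ * (r + k)
      rearrange = solve-∀
    merge : Maybe (+ 9 ∣ℤ u → O) → Maybe (+ 9 ∣ℤ 1ℤ * a + -1ℤ * (r + + 3) → O) →
            Maybe (+ 9 ∣ℤ 1ℤ * a + -1ℤ * (r + + 6) → O) → Maybe (+ 3 ∣ℤ u → O)
    merge (just f₀) (just f₃) (just f₆) = just λ 3∣u → [ f₀ , [ f₃ ∘ shifted (+ 3) , f₆ ∘ shifted (+ 6) ]′ ]′ (mod-nine u 3∣u)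
    merge _ _ _ = nothing

  -- Forms that can vanish on a class modulo 3 may be nonzero modulo 9 on some of its subclasses,
  -- which are then empty.
  pruned : ∀ N r Γ → Maybe (Congruent N r → All (λ f → f · x ≡ 0ℤ) Γ → Outcome x)
  pruned N r []      = nothing
  pruned N r (f ∷ Γ) with + N ∣ℤ? f · r
  ... | no N∤ = just λ { c (z ∷ _) → contradiction (congruent-· f c z) N∤ }
  ... | yes _ = Maybe.map (λ { g c (_ ∷ zs) → g c zs }) (pruned N r Γ)

  difference₁ difference₂ difference₃ : V
  difference₁ = ⟨ 1ℤ , -1ℤ , 0ℤ , 0ℤ ⟩
  difference₂ = ⟨ 1ℤ , 0ℤ , -1ℤ , 0ℤ ⟩
  difference₃ = ⟨ 1ℤ , 0ℤ , 0ℤ , -1ℤ ⟩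

  module Plane (Γ ps : List V) (r : V) where

    equal₁ : difference₁ · x ≡ 0ℤ → V.b x ≡ V.a x
    equal₁ z = sym (ℤ.i-j≡0⇒i≡j (V.a x) (V.b x) (trans (lemma (V.a x) (V.b x) (V.c x) (V.d x)) z))
      where
      lemma : ∀ a b c d → a - b ≡ 1ℤ * a + -1ℤ * b + 0ℤ * c + 0ℤ * d
      lemma = solve-∀
    equal₂ : difference₂ · x ≡ 0ℤ → V.c x ≡ V.a x
    equal₂ z = sym (ℤ.i-j≡0⇒i≡j (V.a x) (V.c x) (trans (lemma (V.a x) (V.b x) (V.c x) (V.d x)) z))
      where
      lemma : ∀ a b c d → a - c ≡ 1ℤ * a + 0ℤ * b + -1ℤ * c + 0ℤ * d
      lemma = solve-∀
    equal₃ : difference₃ · x ≡ 0ℤ → V.d x ≡ V.a x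
    equal₃ z = sym (ℤ.i-j≡0⇒i≡j (V.a x) (V.d x) (trans (lemma (V.a x) (V.b x) (V.c x) (V.d x)) z))
      where
      lemma : ∀ a b c d → a - d ≡ 1ℤ * a + 0ℤ * b + 0ℤ * c + -1ℤ * d
      lemma = solve-∀

    minus-four₁ minus-four₂ minus-four₃ : V
    minus-four₁ = ⟨ - + 4 , 1ℤ , 0ℤ , 0ℤ ⟩
    minus-four₂ = ⟨ - + 4 , 0ℤ , 1ℤ , 0ℤ ⟩
    minus-four₃ = ⟨ - + 4 , 0ℤ , 0ℤ , 1ℤ ⟩

    multiple-of-nine : ∀ f i → f · x ≡ i → Congruent 9 r → + 9 ∣ℤ f · r → + 9 ∣ℤ i
    multiple-of-nine f i eq c 9∣ = subst (+ 9 ∣ℤ_) eq (congruent-∣ f ∣-refl c 9∣)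

    -- The factor 4 has this origin: for d ≡ 4a modulo 9 and a prime to 3, the reflection in
    -- (1,1,0,1) takes (a,a,a,d) to a vector whose only coordinate prime to 3 is a, and every single
    -- reflection integral there fixes that a.
    plane : Maybe (State 9 r Γ ps [] → Outcome x)
    plane with kills? difference₁ ps | kills? difference₂ ps | kills? difference₃ ps
    ... | just k₁ | just k₂ | _ with + 9 ∣ℤ? minus-four₃ · r
    ...   | yes 9∣ = just λ st → plane₁ (equal₁ (State.span st difference₁ k₁)) (equal₂ (State.span st difference₂ k₂))
                       (multiple-of-nine minus-four₃ (V.d x - + 4 * V.a x) (lemma (V.a x) (V.b x) (V.c x) (V.d x)) (State.congruent st) 9∣)
      where
      lemma : ∀ a b c d → - + 4 * a + 0ℤ * b + 0ℤ * c + 1ℤ * d ≡ d - + 4 * a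
      lemma = solve-∀
    ...   | no _ = nothing
    plane | just k₁ | nothing | just k₃ with + 9 ∣ℤ? minus-four₂ · r
    ...   | yes 9∣ = just λ st → plane₂ (equal₁ (State.span st difference₁ k₁)) (equal₃ (State.span st difference₃ k₃))
                       (multiple-of-nine minus-four₂ (V.c x - + 4 * V.a x) (lemma (V.a x) (V.b x) (V.c x) (V.d x)) (State.congruent st) 9∣)
      where
      lemma : ∀ a b c d → - + 4 * a + 0ℤ * b + 1ℤ * c + 0ℤ * d ≡ c - + 4 * a
      lemma = solve-∀
    ...   | no _ = nothing
    plane | nothing | just k₂ | just k₃ with + 9 ∣ℤ? minus-four₁ · r
    ...   | yes 9∣ = just λ st → plane₃ (equal₂ (State.span st difference₂ k₂)) (equal₃ (State.span st difference₃ k₃))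
                       (multiple-of-nine minus-four₁ (V.b x - + 4 * V.a x) (lemma (V.a x) (V.b x) (V.c x) (V.d x)) (State.congruent st) 9∣)
      where
      lemma : ∀ a b c d → - + 4 * a + 1ℤ * b + 0ℤ * c + 0ℤ * d ≡ b - + 4 * a
      lemma = solve-∀
    ...   | no _ = nothing
    plane | _ | _ | _ = nothing

  Covers : ℕ → V → List V → List V → Set
  Covers N r Γ ps = Maybe (Congruent N r → All (λ f → f · x ≡ 0ℤ) Γ → InSpan x ps → Outcome x)

  mutual

    search : ∀ (fuel : ℕ) N r Γ ps ms → Maybe (State N r Γ ps ms → Outcome x)
    search zero       N r Γ ps       ms = nothing
    search (suc fuel) N r Γ (p ∷ []) ms = Maybe.map (λ f st → f (State.span st)) (Leaf.leaf (primitivePart p) p)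
    search (suc fuel) N r Γ ps       ms = Maybe.map (λ f st → f st (State.valid st)) (try fuel N r Γ ps ms ms)

    -- Follows the first move none of whose forms vanishes on all of ps, so that ps shrinks in every branch.
    try : ∀ (fuel : ℕ) N r Γ ps ms todo → Maybe (State N r Γ ps ms → All Attempt todo → Outcome x)
    try fuel 3 r Γ ps ms [] = Maybe.map (λ f (state c zs span _) _ → f c zs span) (split fuel r Γ ps)
    try fuel 9 r Γ ps ms [] = Maybe.map (λ f (state c zs span _) _ → f (state c zs span [])) (Plane.plane Γ ps r)
    try fuel _ r Γ ps ms [] = nothing
    try fuel N r Γ ps ms (fs ∷ todo) with branches N r ps fs
    ... | just bs = Maybe.map (λ { f st (done ∷ _) → decide done (f st) }) (follow fuel N r Γ ps ms fs bs)
    ... | nothing = Maybe.map (λ { f st (_ ∷ rest) → f st rest }) (try fuel N r Γ ps ms todo)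

    follow : ∀ (fuel : ℕ) N r Γ ps ms fs → All (Branch N r ps) fs →
             Maybe (State N r Γ ps ms → All (λ f → f · x ≡ 0ℤ → Outcome x) fs)
    follow fuel N r Γ ps ms []       []                     = just λ _ → []
    follow fuel N r Γ ps ms (f ∷ fs) (closed impossible ∷ bs) =
      Maybe.map (λ rest st → (λ z → contradiction z (impossible (State.congruent st) (State.span st))) ∷ rest st)
        (follow fuel N r Γ ps ms fs bs)
    follow fuel N r Γ ps ms (f ∷ fs) (narrowed qs eq ∷ bs) with search fuel N r (f ∷ Γ) qs ms
    ... | nothing = nothing
    ... | just s  = Maybe.map (λ { rest st@(state c zs span valid) →
                      (λ z → s (state c (z ∷ zs) (eliminate-span f ps eq z span) valid)) ∷ rest st })
                    (follow fuel N r Γ ps ms fs bs)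

    -- All 81 subclasses modulo 9 are visited. Since `refine` handles one integer at a time, the
    -- congruences are curried and handed on coordinate by coordinate.
    split : ∀ (fuel : ℕ) r Γ ps → Covers 3 r Γ ps
    split fuel ⟨ a , b , c , d ⟩ Γ ps =
      Maybe.map (λ f (p , q , r , s) → f p q r s)
        (refine (V.a x) a λ a′ → Maybe.map (λ f 9∣a 3∣b 3∣c 3∣d → f 3∣b 3∣c 3∣d 9∣a)
          (refine (V.b x) b λ b′ → Maybe.map (λ f 9∣b 3∣c 3∣d 9∣a → f 3∣c 3∣d 9∣b 9∣a)
            (refine (V.c x) c λ c′ → Maybe.map (λ f 9∣c 3∣d 9∣b 9∣a → f 3∣d 9∣c 9∣b 9∣a)
              (refine (V.d x) d λ d′ → Maybe.map (λ f 9∣d 9∣c 9∣b 9∣a → f (9∣a , 9∣b , 9∣c , 9∣d))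
                (class fuel ⟨ a′ , b′ , c′ , d′ ⟩ Γ ps)))))

    class : ∀ (fuel : ℕ) r Γ ps → Covers 9 r Γ ps
    class fuel r Γ ps with pruned 9 r Γ
    ... | just f  = just λ c zs _ → f c zs
    ... | nothing = start fuel 9 r Γ ps

    start : ∀ (fuel : ℕ) N r Γ ps → Covers N r Γ ps
    start fuel N r Γ ps = Maybe.map (λ f c zs span → f (state c zs span (allAttempts-valid moves c)))
      (search fuel N r Γ ps (allAttempts N r moves))

basis : List V
basis = e₀ ∷ ⟨ 0ℤ , 1ℤ , 0ℤ , 0ℤ ⟩ ∷ ⟨ 0ℤ , 0ℤ , 1ℤ , 0ℤ ⟩ ∷ ⟨ 0ℤ , 0ℤ , 0ℤ , 1ℤ ⟩ ∷ []

basis-span : ∀ x → InSpan x basis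
basis-span x ⟨ e , f , g , h ⟩ (p ∷ q ∷ r ∷ s ∷ []) =
  vanish (trans (i₀ e f g h) p) (trans (i₁ e f g h) q) (trans (i₂ e f g h) r) (trans (i₃ e f g h) s)
  where
  i₀ : ∀ e f g h → e ≡ e * 1ℤ + f * 0ℤ + g * 0ℤ + h * 0ℤ
  i₀ = solve-∀
  i₁ : ∀ e f g h → f ≡ e * 0ℤ + f * 1ℤ + g * 0ℤ + h * 0ℤ
  i₁ = solve-∀
  i₂ : ∀ e f g h → g ≡ e * 0ℤ + f * 0ℤ + g * 1ℤ + h * 0ℤ
  i₂ = solve-∀
  i₃ : ∀ e f g h → h ≡ e * 0ℤ + f * 0ℤ + g * 0ℤ + h * 1ℤ
  i₃ = solve-∀
  vanish : ∀ {e f g h a b c d} → e ≡ 0ℤ → f ≡ 0ℤ → g ≡ 0ℤ → h ≡ 0ℤ → e * a + f * b + g * c + h * d ≡ 0ℤ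
  vanish {a = a} {b} {c} {d} refl refl refl refl = lemma a b c d
    where
    lemma : ∀ a b c d → 0ℤ * a + 0ℤ * b + 0ℤ * c + 0ℤ * d ≡ 0ℤ
    lemma = solve-∀

extract : ∀ {A : Set} (m : Maybe A) → is-just m ≡ true → A
extract (just a) _ = a

-- The outcome of `is-just` does not involve x or `x₀≢0`, so `refl` proves it for symbolic x. Fuel 5
-- is one unit for each dimension from 4 down to 1 and one for the only passage from modulus 3 to 9.
by-search : ∀ x (x₀≢0 : V.a x ≢ 0ℤ) N r → is-just (Search.start x x₀≢0 5 N r [] basis) ≡ true →
            Search.Congruent x x₀≢0 N r → Outcome x
by-search x x₀≢0 N r ok c = extract (Search.start x x₀≢0 5 N r [] basis) ok c [] (basis-span x)

by-splitting : ∀ x (x₀≢0 : V.a x ≢ 0ℤ) r → is-just (Search.split x x₀≢0 5 r [] basis) ≡ true →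
               Search.Congruent x x₀≢0 3 r → Outcome x
by-splitting x x₀≢0 r ok c = extract (Search.split x x₀≢0 5 r [] basis) ok c [] (basis-span x)

-- Reduction to finitely many classes modulo 9

NotAll : ℕ → ℤ → ℤ → ℤ → Set
NotAll q b c d = ¬ ((+ q ∣ℤ b) × (+ q ∣ℤ c) × (+ q ∣ℤ d))

-- The second alternative comes from the multiples of the pair (5, 79).
Solved : ℕ → ℤ → ℤ → Set
Solved p n r = (∃ λ y → norm y ≡ n × Avoids r y)
             ⊎ (∃ λ k → ∣ r ∣ ≡ 5 ℕ.* ∣ k ∣ × n ≡ k * k * + 79 × ¬ (+ p ∣ℤ k))

∣-neg : ∀ {m i} → m ∣ℤ - i → m ∣ℤ i
∣-neg {m} {i} m∣ = subst (m ∣ℤ_) (ℤ.neg-involutive i) (∣m⇒∣-m m∣)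

avoids-neg : ∀ r y → Avoids (- r) y → Avoids r y
avoids-neg r ⟨ a , b , c , d ⟩ (p , q , s , t) = swap p , swap q , swap s , swap t
  where
  swap : ∀ {i} → i ≢ - r × i ≢ - - r → i ≢ r × i ≢ - r
  swap (≢-r , ≢r) = ≢r ∘ (λ eq → trans eq (sym (ℤ.neg-involutive r))) , ≢-r

solved-neg : ∀ {p n} r → Solved p n (- r) → Solved p n r
solved-neg r (inj₁ (y , eq , av))     = inj₁ (y , eq , avoids-neg r y av)
solved-neg r (inj₂ (k , eq , n≡ , p∤)) = inj₂ (k , trans (sym (ℤ.∣-i∣≡∣i∣ r)) eq , n≡ , p∤)

data Residue (i : ℤ) : Set where
  is-0  : + 3 ∣ℤ i → Residue i
  is-1  : + 3 ∣ℤ i - 1ℤ → Residue i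
  is--1 : + 3 ∣ℤ - i - 1ℤ → Residue i

residue : ∀ i → Residue i
residue i = by-remainder (i %ℕ 3) (n%ℕd<d i 3) (a≡a%ℕn+[a/ℕn]*n i 3)
  where
  k = i /ℕ 3
  zeroth : ∀ k → + 0 + k * + 3 ≡ k * + 3
  zeroth = solve-∀
  first : ∀ k → + 1 + k * + 3 - 1ℤ ≡ k * + 3
  first = solve-∀
  second : ∀ k → - (+ 2 + k * + 3) - 1ℤ ≡ (- k - 1ℤ) * + 3
  second = solve-∀
  by-remainder : ∀ r → r ℕ.< 3 → i ≡ + r + k * + 3 → Residue i
  by-remainder 0 _ eq = is-0 (divides k (trans eq (zeroth k)))
  by-remainder 1 _ eq = is-1 (divides k (trans (cong (_- 1ℤ) eq) (first k)))
  by-remainder 2 _ eq = is--1 (divides (- k - 1ℤ) (trans (cong (λ i → - i - 1ℤ) eq) (second k)))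
  by-remainder (suc (suc (suc _))) (s≤s (s≤s (s≤s ()))) _

-- Signs and order can be normalised so that the residues mod 3 are 1, …, 1, 0, …, 0.
module Normalise (P : ℤ → ℤ → ℤ → Set)
  (negate : ∀ b c d → P (- b) c d → P b c d)
  (swap₁₂ : ∀ b c d → P c b d → P b c d)
  (swap₂₃ : ∀ b c d → P b d c → P b c d)
  (case₀₀₀ : ∀ b c d → + 3 ∣ℤ b → + 3 ∣ℤ c → + 3 ∣ℤ d → P b c d)
  (case₁₀₀ : ∀ b c d → + 3 ∣ℤ b - 1ℤ → + 3 ∣ℤ c → + 3 ∣ℤ d → P b c d)
  (case₁₁₀ : ∀ b c d → + 3 ∣ℤ b - 1ℤ → + 3 ∣ℤ c - 1ℤ → + 3 ∣ℤ d → P b c d)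
  (case₁₁₁ : ∀ b c d → + 3 ∣ℤ b - 1ℤ → + 3 ∣ℤ c - 1ℤ → + 3 ∣ℤ d - 1ℤ → P b c d)
  where

  Bit : ℤ → Set
  Bit i = (+ 3 ∣ℤ i) ⊎ (+ 3 ∣ℤ i - 1ℤ)

  bits : ∀ b c d → Bit b → Bit c → Bit d → P b c d
  bits b c d (inj₁ p) (inj₁ q) (inj₁ r) = case₀₀₀ b c d p q r
  bits b c d (inj₁ p) (inj₁ q) (inj₂ r) = swap₂₃ b c d (swap₁₂ b d c (case₁₀₀ d b c r p q))
  bits b c d (inj₁ p) (inj₂ q) (inj₁ r) = swap₁₂ b c d (case₁₀₀ c b d q p r)
  bits b c d (inj₁ p) (inj₂ q) (inj₂ r) = swap₁₂ b c d (swap₂₃ c b d (case₁₁₀ c d b q r p))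
  bits b c d (inj₂ p) (inj₁ q) (inj₁ r) = case₁₀₀ b c d p q r
  bits b c d (inj₂ p) (inj₁ q) (inj₂ r) = swap₂₃ b c d (case₁₁₀ b d c p r q)
  bits b c d (inj₂ p) (inj₂ q) (inj₁ r) = case₁₁₀ b c d p q r
  bits b c d (inj₂ p) (inj₂ q) (inj₂ r) = case₁₁₁ b c d p q r

  first-bit : ∀ b c d → (∀ b → Bit b → P b c d) → P b c d
  first-bit b c d f with residue b
  ... | is-0 p  = f b (inj₁ p)
  ... | is-1 p  = f b (inj₂ p)
  ... | is--1 p = negate b c d (f (- b) (inj₂ p))

  -- Only the first argument of P can be negated, so each argument is brought to the front in turn.
  normalise : ∀ b c d → P b c d
  normalise b c d = first-bit b c d λ b β → swap₁₂ b c d (first-bit c b d λ c γ → swap₂₃ c b d (swap₁₂ c d b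
    (first-bit d c b λ d δ → bits d c b δ γ β)))

notAll-neg : ∀ {q b c d} → NotAll q b c d → NotAll q (- b) c d
notAll-neg ¬all (p , r) = ¬all (∣-neg p , r)

notAll-swap₁₂ : ∀ {q b c d} → NotAll q b c d → NotAll q c b d
notAll-swap₁₂ ¬all (p , r , s) = ¬all (r , p , s)

notAll-swap₂₃ : ∀ {q b c d} → NotAll q b c d → NotAll q b d c
notAll-swap₂₃ ¬all (p , r , s) = ¬all (p , s , r)

norm-neg : ∀ a b c d → norm ⟨ a , - b , c , d ⟩ ≡ norm ⟨ a , b , c , d ⟩
norm-neg = lemma
  where
  lemma : ∀ a b c d → a * a + - b * - b + c * c + d * d ≡ a * a + b * b + c * c + d * d
  lemma = solve-∀

norm-swap₁₂ : ∀ a b c d → norm ⟨ a , c , b , d ⟩ ≡ norm ⟨ a , b , c , d ⟩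
norm-swap₁₂ = lemma
  where
  lemma : ∀ a b c d → a * a + c * c + b * b + d * d ≡ a * a + b * b + c * c + d * d
  lemma = solve-∀

norm-swap₂₃ : ∀ a b c d → norm ⟨ a , b , d , c ⟩ ≡ norm ⟨ a , b , c , d ⟩
norm-swap₂₃ = lemma
  where
  lemma : ∀ a b c d → a * a + b * b + d * d + c * c ≡ a * a + b * b + c * c + d * d
  lemma = solve-∀

norm-swap₀₁ : ∀ a b c d → norm ⟨ b , a , c , d ⟩ ≡ norm ⟨ a , b , c , d ⟩
norm-swap₀₁ = lemma
  where
  lemma : ∀ a b c d → b * b + a * a + c * c + d * d ≡ a * a + b * b + c * c + d * d
  lemma = solve-∀

-- Removing powers of 3 from three coordinates while keeping their norm

module Triples {p : ℕ} (pp : Prime p) (p∤6 : ¬ + p ∣ℤ + 6) where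

  p∤2 : ¬ + p ∣ℤ + 2
  p∤2 p∣2 = p∤6 (∣n⇒∣m*n (+ 3) p∣2)

  p∤3 : ¬ + p ∣ℤ + 3
  p∤3 p∣3 = p∤6 (∣n⇒∣m*n (+ 2) p∣3)

  cancel : ∀ m i → ¬ + p ∣ℤ m → + p ∣ℤ m * i → + p ∣ℤ i
  cancel m i p∤m p∣ = [ (λ p∣m → contradiction p∣m p∤m) , (λ p∣i → p∣i) ]′ (euclid pp m i p∣)

  Triple : ℤ → ℤ → ℤ → Set
  Triple b c d = ∃ λ b′ → ∃₂ λ c′ d′ →
    b′ * b′ + c′ * c′ + d′ * d′ ≡ b * b + c * c + d * d × NotAll p b′ c′ d′ × NotAll 3 b′ c′ d′

  module Reflect (s t : ℤ) (s² : s * s ≡ 1ℤ) (t² : t * t ≡ 1ℤ) (b c d : ℤ) where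
    u b′ c′ d′ : ℤ
    u  = b + s * c + t * d
    b′ = + 3 * b - + 2 * u
    c′ = + 3 * c - + 2 * u * s
    d′ = + 3 * d - + 2 * u * t

    norm-reflected : b′ * b′ + c′ * c′ + d′ * d′ ≡ + 9 * (b * b + c * c + d * d)
    norm-reflected = trans (expand b c d s t u) (simplify (b * b + c * c + d * d) u s² t²)
      where
      expand : ∀ b c d s t u → (+ 3 * b - + 2 * u) * (+ 3 * b - + 2 * u) + (+ 3 * c - + 2 * u * s) * (+ 3 * c - + 2 * u * s)
        + (+ 3 * d - + 2 * u * t) * (+ 3 * d - + 2 * u * t)
        ≡ + 9 * (b * b + c * c + d * d) - + 12 * u * (b + s * c + t * d) + + 4 * u * u * (1ℤ + s * s + t * t)
      expand = solve-∀
      simplify : ∀ n u {x y} → x ≡ 1ℤ → y ≡ 1ℤ → + 9 * n - + 12 * u * u + + 4 * u * u * (1ℤ + x + y) ≡ + 9 * n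
      simplify n u refl refl = lemma n u
        where
        lemma : ∀ n u → + 9 * n - + 12 * u * u + + 4 * u * u * (1ℤ + 1ℤ + 1ℤ) ≡ + 9 * n
        lemma = solve-∀

    -- A reflection reverses its own vector: b′ + s c′ + t d′ = -3u, and 3 is invertible modulo p.
    p∣u : + p ∣ℤ b′ → + p ∣ℤ c′ → + p ∣ℤ d′ → + p ∣ℤ u
    p∣u p∣b p∣c p∣d = cancel (+ 3) u p∤3 (subst (+ p ∣ℤ_) (trans (expand b c d s t u) (simplify u s² t²))
      (∣m⇒∣-m (∣m∣n⇒∣m+n (∣m∣n⇒∣m+n p∣b (∣n⇒∣m*n s p∣c)) (∣n⇒∣m*n t p∣d))))
      where
      expand : ∀ b c d s t u → - (+ 3 * b - + 2 * u + s * (+ 3 * c - + 2 * u * s) + t * (+ 3 * d - + 2 * u * t))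
        ≡ + 2 * u * (1ℤ + s * s + t * t) - + 3 * (b + s * c + t * d)
      expand = solve-∀
      simplify : ∀ u {x y} → x ≡ 1ℤ → y ≡ 1ℤ → + 2 * u * (1ℤ + x + y) - + 3 * u ≡ + 3 * u
      simplify u refl refl = lemma u
        where
        lemma : ∀ u → + 2 * u * (1ℤ + 1ℤ + 1ℤ) - + 3 * u ≡ + 3 * u
        lemma = solve-∀

    back : ∀ i v → + p ∣ℤ u → + p ∣ℤ + 3 * i - + 2 * u * v → + p ∣ℤ i
    back i v p∣u p∣ = cancel (+ 3) i p∤3 (subst (+ p ∣ℤ_) (lemma i u v) (∣m∣n⇒∣m+n p∣ (∣n⇒∣m*n (+ 2 * v) p∣u)))
      where
      lemma : ∀ i u v → + 3 * i - + 2 * u * v + + 2 * v * u ≡ + 3 * i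
      lemma = solve-∀

    not-all-p : NotAll p b c d → NotAll p b′ c′ d′
    not-all-p ¬all (p∣b , p∣c , p∣d) =
      ¬all (back b 1ℤ p∣ (subst (λ v → + p ∣ℤ + 3 * b - v) (sym (ℤ.*-identityʳ (+ 2 * u))) p∣b) , back c s p∣ p∣c , back d t p∣ p∣d)
      where p∣ = p∣u p∣b p∣c p∣d

    -- Modulo 3, b′ ≡ -2u ≡ u.
    3∤b′ : ¬ + 3 ∣ℤ u → ¬ + 3 ∣ℤ b′
    3∤b′ 3∤u 3∣ = 3∤u (subst (+ 3 ∣ℤ_) (lemma b u) (∣m∣n⇒∣m+n 3∣ (∣m⇒∣m*n {+ 3} (u - b) ∣-refl)))
      where
      lemma : ∀ b u → + 3 * b - + 2 * u + + 3 * (u - b) ≡ u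
      lemma = solve-∀

    triple : NotAll p b c d → ¬ + 3 ∣ℤ u → Triple (+ 3 * b) (+ 3 * c) (+ 3 * d)
    triple ¬all 3∤u = b′ , c′ , d′ , trans norm-reflected (nine b c d) , not-all-p ¬all , λ { (3∣ , _) → 3∤b′ 3∤u 3∣ }
      where
      nine : ∀ b c d → + 9 * (b * b + c * c + d * d) ≡ + 3 * b * (+ 3 * b) + + 3 * c * (+ 3 * c) + + 3 * d * (+ 3 * d)
      nine = solve-∀

  divide-two : ∀ i {j} → j ≡ + 2 * i → + 3 ∣ℤ j → + 3 ∣ℤ i
  divide-two i refl 3∣ = subst (+ 3 ∣ℤ_) (lemma i) (∣m∣n⇒∣m+n (∣m⇒∣-m 3∣) (∣m⇒∣m*n {+ 3} i ∣-refl))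
    where
    lemma : ∀ i → - (+ 2 * i) + + 3 * i ≡ i
    lemma = solve-∀

  -- The four forms b ± c ± d add and subtract to 2b, 2c and 2d, so 3 cannot divide all of them. A
  -- reflection whose form is prime to 3 then works.
  triple-of-triple : ∀ b c d → NotAll p b c d → NotAll 3 b c d → Triple (+ 3 * b) (+ 3 * c) (+ 3 * d)
  triple-of-triple b c d ¬all ¬all₃ = choose (+ 3 ∣ℤ? R₁.u) (+ 3 ∣ℤ? R₂.u) (+ 3 ∣ℤ? R₃.u) (+ 3 ∣ℤ? R₄.u)
    where
    module R₁ = Reflect 1ℤ 1ℤ refl refl b c d
    module R₂ = Reflect -1ℤ -1ℤ refl refl b c d
    module R₃ = Reflect 1ℤ -1ℤ refl refl b c d
    module R₄ = Reflect -1ℤ 1ℤ refl refl b c d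
    sum-b : ∀ b c d → b + 1ℤ * c + 1ℤ * d + (b + -1ℤ * c + -1ℤ * d) ≡ + 2 * b
    sum-b = solve-∀
    sum-c : ∀ b c d → b + 1ℤ * c + 1ℤ * d - (b + -1ℤ * c + 1ℤ * d) ≡ + 2 * c
    sum-c = solve-∀
    sum-d : ∀ b c d → b + 1ℤ * c + 1ℤ * d - (b + 1ℤ * c + -1ℤ * d) ≡ + 2 * d
    sum-d = solve-∀
    choose : Dec (+ 3 ∣ℤ R₁.u) → Dec (+ 3 ∣ℤ R₂.u) → Dec (+ 3 ∣ℤ R₃.u) → Dec (+ 3 ∣ℤ R₄.u) → Triple (+ 3 * b) (+ 3 * c) (+ 3 * d)
    choose (no 3∤) _ _ _ = R₁.triple ¬all 3∤
    choose (yes _) (no 3∤) _ _ = R₂.triple ¬all 3∤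
    choose (yes _) (yes _) (no 3∤) _ = R₃.triple ¬all 3∤
    choose (yes _) (yes _) (yes _) (no 3∤) = R₄.triple ¬all 3∤
    choose (yes p₁) (yes p₂) (yes p₃) (yes p₄) = contradiction
      ( divide-two b (sum-b b c d) (∣m∣n⇒∣m+n p₁ p₂) , divide-two c (sum-c b c d) (∣m∣n⇒∣m-n p₁ p₄)
      , divide-two d (sum-d b c d) (∣m∣n⇒∣m-n p₁ p₃)) ¬all₃

  -- A common factor 3 is divided out before the recursive call. On the way back `enlarge` absorbs
  -- it again by one reflection, so the norm is restored but the divisibility is not. The size
  -- shrinks because `NotAll p` excludes the zero triple.
  triple : ∀ b c d → NotAll p b c d → Triple b c d
  triple b c d = go b c d (<-wellFounded _)
    where
    size : ℤ → ℤ → ℤ → ℕ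
    size b c d = ∣ b ∣ ℕ.+ ∣ c ∣ ℕ.+ ∣ d ∣

    size-triple : ∀ b c d → size (+ 3 * b) (+ 3 * c) (+ 3 * d) ≡ size b c d ℕ.* 3
    size-triple b c d = trans (cong₂ ℕ._+_ (cong₂ ℕ._+_ (ℤ.abs-* (+ 3) b) (ℤ.abs-* (+ 3) c)) (ℤ.abs-* (+ 3) d))
      (lemma (∣ b ∣) (∣ c ∣) (∣ d ∣))
      where
      lemma : ∀ b c d → 3 ℕ.* b ℕ.+ 3 ℕ.* c ℕ.+ 3 ℕ.* d ≡ (b ℕ.+ c ℕ.+ d) ℕ.* 3
      lemma = ℕSolver.solve-∀

    size≢0 : ∀ b c d → NotAll p b c d → size b c d ≢ 0
    size≢0 b c d ¬all eq = ¬all (vanishing b (ℕ.m+n≡0⇒m≡0 (∣ b ∣) eq′) , vanishing c (ℕ.m+n≡0⇒n≡0 (∣ b ∣) eq′)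
                               , vanishing d (ℕ.m+n≡0⇒n≡0 (∣ b ∣ ℕ.+ ∣ c ∣) eq))
      where
      eq′ = ℕ.m+n≡0⇒m≡0 (∣ b ∣ ℕ.+ ∣ c ∣) eq
      vanishing : ∀ i → ∣ i ∣ ≡ 0 → + p ∣ℤ i
      vanishing i eq = divides 0ℤ (ℤ.∣i∣≡0⇒i≡0 eq)

    notAll-third : ∀ {b c d} → NotAll p (+ 3 * b) (+ 3 * c) (+ 3 * d) → NotAll p b c d
    notAll-third ¬all (q , r , s) = ¬all (∣n⇒∣m*n (+ 3) q , ∣n⇒∣m*n (+ 3) r , ∣n⇒∣m*n (+ 3) s)

    enlarge : ∀ b c d → Triple b c d → Triple (+ 3 * b) (+ 3 * c) (+ 3 * d)
    enlarge b c d (b′ , c′ , d′ , eq , ¬all , ¬all₃) with triple-of-triple b′ c′ d′ ¬all ¬all₃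
    ... | b″ , c″ , d″ , eq′ , rest = b″ , c″ , d″ , trans eq′ (nine b′ c′ d′ b c d eq) , rest
      where
      factor : ∀ b c d → + 3 * b * (+ 3 * b) + + 3 * c * (+ 3 * c) + + 3 * d * (+ 3 * d) ≡ + 9 * (b * b + c * c + d * d)
      factor = solve-∀
      nine : ∀ b′ c′ d′ b c d → b′ * b′ + c′ * c′ + d′ * d′ ≡ b * b + c * c + d * d →
        + 3 * b′ * (+ 3 * b′) + + 3 * c′ * (+ 3 * c′) + + 3 * d′ * (+ 3 * d′) ≡ + 3 * b * (+ 3 * b) + + 3 * c * (+ 3 * c) + + 3 * d * (+ 3 * d)
      nine b′ c′ d′ b c d eq = trans (factor b′ c′ d′) (trans (cong (+ 9 *_) eq) (sym (factor b c d)))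

    go : ∀ b c d → Acc ℕ._<_ (size b c d) → NotAll p b c d → Triple b c d

    descend : ∀ b c d b₁ c₁ d₁ → b ≡ + 3 * b₁ → c ≡ + 3 * c₁ → d ≡ + 3 * d₁ →
              Acc ℕ._<_ (size b c d) → NotAll p b c d → Triple b c d
    descend _ _ _ b c d refl refl refl (acc rs) ¬all = enlarge b c d (go b c d
      (rs (subst (size b c d ℕ.<_) (sym (size-triple b c d)) (ℕ.m<m*n (size b c d) 3 (s≤s (s≤s z≤n))))) ¬all′)
      where
      ¬all′ = notAll-third ¬all
      instance _ = ℕ.≢-nonZero (size≢0 b c d ¬all′)

    go b c d ac ¬all with + 3 ∣ℤ? b | + 3 ∣ℤ? c | + 3 ∣ℤ? d
    ... | no 3∤b | _ | _ = b , c , d , refl , ¬all , (λ (3∣b , _) → 3∤b 3∣b)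
    ... | yes _ | no 3∤c | _ = b , c , d , refl , ¬all , (λ (_ , 3∣c , _) → 3∤c 3∣c)
    ... | yes _ | yes _ | no 3∤d = b , c , d , refl , ¬all , (λ (_ , _ , 3∣d) → 3∤d 3∣d)
    ... | yes (divides b₁ b≡) | yes (divides c₁ c≡) | yes (divides d₁ d≡) =
      descend b c d b₁ c₁ d₁ (trans b≡ (ℤ.*-comm b₁ (+ 3))) (trans c≡ (ℤ.*-comm c₁ (+ 3))) (trans d≡ (ℤ.*-comm d₁ (+ 3))) ac ¬all

-- Representations primitive at p, by residue classes modulo 3 and 9

module Solve {p : ℕ} (pp : Prime p) (p∤6 : ¬ + p ∣ℤ + 6) where

  open Triples pp p∤6

  p∤216 : ∀ i → ∣ i ∣ ℕ.∣ 216 → ¬ + p ∣ℤ i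
  p∤216 i i∣216 p∣i = [ p∤6 , (λ p∣36 → [ p∤6 , p∤6 ]′ (euclid pp (+ 6) (+ 6) p∣36)) ]′
    (euclid pp (+ 6) (+ 36) (∣-trans p∣i (∣ᵤ⇒∣ i∣216)))

  module Fixed (a : ℤ) (p∣a : + p ∣ℤ a) (a≢0 : a ≢ 0ℤ) where

    transport : ∀ {n n′} → n ≡ n′ → Solved p n a → Solved p n′ a
    transport = subst (λ n → Solved p n a)

    from-outcome : ∀ b c d → NotAll p b c d →
      (b ≡ a → c ≡ a → + 9 ∣ℤ d - + 4 * a → Solved p (norm ⟨ a , b , c , d ⟩) a) →
      (b ≡ a → d ≡ a → + 9 ∣ℤ c - + 4 * a → Solved p (norm ⟨ a , b , c , d ⟩) a) →
      (c ≡ a → d ≡ a → + 9 ∣ℤ b - + 4 * a → Solved p (norm ⟨ a , b , c , d ⟩) a) →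
      Outcome ⟨ a , b , c , d ⟩ → Solved p (norm ⟨ a , b , c , d ⟩) a
    from-outcome b c d ¬all P₁ P₂ P₃ (good y eq av) = inj₁ (y , eq , av)
    from-outcome b c d ¬all P₁ P₂ P₃ (ray s smooth (e₁ , e₂ , e₃)) =
      contradiction (divides′ b (V.b s) e₁ , divides′ c (V.c s) e₂ , divides′ d (V.d s) e₃) ¬all
      where
      divides′ : ∀ i t → V.a s * i ≡ t * a → + p ∣ℤ i
      divides′ i t eq = cancel (V.a s) i (p∤216 (V.a s) smooth) (subst (+ p ∣ℤ_) (sym eq) (∣n⇒∣m*n t p∣a))
    from-outcome b c d ¬all P₁ P₂ P₃ (exceptional k ⟨ s₀ , s₁ , s₂ , s₃ ⟩ eq s₀≡5 n≡79) = inj₂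
      ( k
      , trans (cong (∣_∣ ∘ V.a) eq) (trans (ℤ.abs-* k s₀) (trans (cong (∣ k ∣ ℕ.*_) s₀≡5) (ℕ.*-comm (∣ k ∣) 5)))
      , trans (cong norm eq) (trans (norm-scale k ⟨ s₀ , s₁ , s₂ , s₃ ⟩) (cong (k * k *_) n≡79))
      , λ p∣k → ¬all (multiple p∣k (cong V.b eq) , multiple p∣k (cong V.c eq) , multiple p∣k (cong V.d eq)))
      where
      multiple : ∀ {i t} → + p ∣ℤ k → i ≡ k * t → + p ∣ℤ i
      multiple {t = t} p∣k eq = subst (+ p ∣ℤ_) (sym eq) (∣m⇒∣m*n t p∣k)
    from-outcome b c d ¬all P₁ P₂ P₃ (plane₁ p q r) = P₁ p q r
    from-outcome b c d ¬all P₁ P₂ P₃ (plane₂ p q r) = P₂ p q r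
    from-outcome b c d ¬all P₁ P₂ P₃ (plane₃ p q r) = P₃ p q r

    subtract₀ : ∀ {m} i → m ∣ℤ i → m ∣ℤ 1ℤ * i + -1ℤ * 0ℤ
    subtract₀ {m} i = subst (m ∣ℤ_) (lemma i)
      where
      lemma : ∀ i → i ≡ 1ℤ * i + -1ℤ * 0ℤ
      lemma = solve-∀

    subtract : ∀ {m} i k → m ∣ℤ i - k → m ∣ℤ 1ℤ * i + -1ℤ * k
    subtract {m} i k = subst (m ∣ℤ_) (lemma i k)
      where
      lemma : ∀ i k → i - k ≡ 1ℤ * i + -1ℤ * k
      lemma = solve-∀

    nine₀ : ∀ i → + 3 ∣ℤ i → + 9 ∣ℤ 1ℤ * (+ 3 * i) + -1ℤ * 0ℤ
    nine₀ i 3∣i = subtract₀ (+ 3 * i) (*-monoʳ-∣ (+ 3) 3∣i)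

    nine₁ : ∀ i → + 3 ∣ℤ i - 1ℤ → + 9 ∣ℤ 1ℤ * (+ 3 * i) + -1ℤ * + 3
    nine₁ i 3∣ = subst (+ 9 ∣ℤ_) (lemma i) (*-monoʳ-∣ (+ 3) 3∣)
      where
      lemma : ∀ i → + 3 * (i - 1ℤ) ≡ 1ℤ * (+ 3 * i) + -1ℤ * + 3
      lemma = solve-∀

    module Unit (3∣a-1 : + 3 ∣ℤ a - 1ℤ) where

      3∤a : ¬ + 3 ∣ℤ a
      3∤a 3∣a = contradiction (∣⇒∣ᵤ (∣m+n∣m⇒∣n 3∣a-1 3∣a)) λ { (ℕ.divides zero ()) ; (ℕ.divides (suc _) ()) }

      P : ℤ → ℤ → ℤ → Set
      P b c d = NotAll p b c d → NotAll 3 b c d → Solved p (norm ⟨ a , + 3 * b , + 3 * c , + 3 * d ⟩) a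

      notAll-scale : ∀ {b c d} → NotAll p b c d → NotAll p (+ 3 * b) (+ 3 * c) (+ 3 * d)
      notAll-scale {b} {c} {d} ¬all (q , r , s) = ¬all (cancel (+ 3) b p∤3 q , cancel (+ 3) c p∤3 r , cancel (+ 3) d p∤3 s)

      conclude : ∀ b c d → Outcome ⟨ a , + 3 * b , + 3 * c , + 3 * d ⟩ → P b c d
      conclude b c d o ¬all _ = from-outcome (+ 3 * b) (+ 3 * c) (+ 3 * d) (notAll-scale ¬all)
          (λ eq _ _ → impossible b eq) (λ eq _ _ → impossible b eq) (λ eq _ _ → impossible c eq) o
        where
        impossible : ∀ {A : Set} i → + 3 * i ≡ a → A
        impossible i eq = contradiction (subst (+ 3 ∣ℤ_) eq (∣m⇒∣m*n {+ 3} i ∣-refl)) 3∤a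

      Mod9 : Set
      Mod9 = (+ 9 ∣ℤ a - 1ℤ) ⊎ (+ 9 ∣ℤ a - + 4) ⊎ (+ 9 ∣ℤ a - + 7)

      mod9 : Mod9
      mod9 = [ inj₁ , [ (λ 9∣ → inj₂ (inj₁ (subst (+ 9 ∣ℤ_) (four a) 9∣))) , (λ 9∣ → inj₂ (inj₂ (subst (+ 9 ∣ℤ_) (seven a) 9∣))) ]′ ]′
        (mod-nine (a - 1ℤ) 3∣a-1)
        where
        four : ∀ a → a - 1ℤ - + 3 ≡ a - + 4
        four = solve-∀
        seven : ∀ a → a - 1ℤ - + 6 ≡ a - + 7
        seven = solve-∀

      by : ∀ b c d r → is-just (Search.start ⟨ a , + 3 * b , + 3 * c , + 3 * d ⟩ a≢0 5 9 r [] basis) ≡ true →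
           Search.Congruent ⟨ a , + 3 * b , + 3 * c , + 3 * d ⟩ a≢0 9 r → P b c d
      by b c d r ok congruent = conclude b c d (by-search ⟨ a , + 3 * b , + 3 * c , + 3 * d ⟩ a≢0 9 r ok congruent)

      case₁₀₀ : Mod9 → ∀ b c d → + 3 ∣ℤ b - 1ℤ → + 3 ∣ℤ c → + 3 ∣ℤ d → P b c d
      case₁₀₀ (inj₁ 9∣)        b c d p q r = by b c d ⟨ + 1 , + 3 , 0ℤ , 0ℤ ⟩ refl (subtract a (+ 1) 9∣ , nine₁ b p , nine₀ c q , nine₀ d r)
      case₁₀₀ (inj₂ (inj₁ 9∣)) b c d p q r = by b c d ⟨ + 4 , + 3 , 0ℤ , 0ℤ ⟩ refl (subtract a (+ 4) 9∣ , nine₁ b p , nine₀ c q , nine₀ d r)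
      case₁₀₀ (inj₂ (inj₂ 9∣)) b c d p q r = by b c d ⟨ + 7 , + 3 , 0ℤ , 0ℤ ⟩ refl (subtract a (+ 7) 9∣ , nine₁ b p , nine₀ c q , nine₀ d r)

      case₁₁₀ : Mod9 → ∀ b c d → + 3 ∣ℤ b - 1ℤ → + 3 ∣ℤ c - 1ℤ → + 3 ∣ℤ d → P b c d
      case₁₁₀ (inj₁ 9∣)        b c d p q r = by b c d ⟨ + 1 , + 3 , + 3 , 0ℤ ⟩ refl (subtract a (+ 1) 9∣ , nine₁ b p , nine₁ c q , nine₀ d r)
      case₁₁₀ (inj₂ (inj₁ 9∣)) b c d p q r = by b c d ⟨ + 4 , + 3 , + 3 , 0ℤ ⟩ refl (subtract a (+ 4) 9∣ , nine₁ b p , nine₁ c q , nine₀ d r)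
      case₁₁₀ (inj₂ (inj₂ 9∣)) b c d p q r = by b c d ⟨ + 7 , + 3 , + 3 , 0ℤ ⟩ refl (subtract a (+ 7) 9∣ , nine₁ b p , nine₁ c q , nine₀ d r)

      case₁₁₁ : Mod9 → ∀ b c d → + 3 ∣ℤ b - 1ℤ → + 3 ∣ℤ c - 1ℤ → + 3 ∣ℤ d - 1ℤ → P b c d
      case₁₁₁ (inj₁ 9∣)        b c d p q r = by b c d ⟨ + 1 , + 3 , + 3 , + 3 ⟩ refl (subtract a (+ 1) 9∣ , nine₁ b p , nine₁ c q , nine₁ d r)
      case₁₁₁ (inj₂ (inj₁ 9∣)) b c d p q r = by b c d ⟨ + 4 , + 3 , + 3 , + 3 ⟩ refl (subtract a (+ 4) 9∣ , nine₁ b p , nine₁ c q , nine₁ d r)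
      case₁₁₁ (inj₂ (inj₂ 9∣)) b c d p q r = by b c d ⟨ + 7 , + 3 , + 3 , + 3 ⟩ refl (subtract a (+ 7) 9∣ , nine₁ b p , nine₁ c q , nine₁ d r)

      negate : ∀ b c d → P (- b) c d → P b c d
      negate b c d s ¬all ¬all₃ = transport (lemma a b (+ 3 * c) (+ 3 * d)) (s (notAll-neg ¬all) (notAll-neg ¬all₃))
        where
        lemma : ∀ a b c d → a * a + + 3 * - b * (+ 3 * - b) + c * c + d * d ≡ a * a + + 3 * b * (+ 3 * b) + c * c + d * d
        lemma = solve-∀

      swap₁₂ : ∀ b c d → P c b d → P b c d
      swap₁₂ b c d s ¬all ¬all₃ =
        transport (norm-swap₁₂ a (+ 3 * b) (+ 3 * c) (+ 3 * d)) (s (notAll-swap₁₂ ¬all) (notAll-swap₁₂ ¬all₃))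

      swap₂₃ : ∀ b c d → P b d c → P b c d
      swap₂₃ b c d s ¬all ¬all₃ =
        transport (norm-swap₂₃ a (+ 3 * b) (+ 3 * c) (+ 3 * d)) (s (notAll-swap₂₃ ¬all) (notAll-swap₂₃ ¬all₃))

      -- One reflection cannot help, since the integral ones fix a. But as b, c, d are not all
      -- divisible by 3, some reflection in (0,±1,±1,±1) makes the last three coordinates not all
      -- divisible by 3, and a second one can then move a. This is why words of length two and
      -- residues modulo 9 are used.
      tripled : ∀ b c d → P b c d
      tripled = Normalise.normalise P negate swap₁₂ swap₂₃ (λ _ _ _ q r s _ ¬all₃ → contradiction (q , r , s) ¬all₃)
        (case₁₀₀ mod9) (case₁₁₀ mod9) (case₁₁₁ mod9)

      -- With d = 4a + 9e, the reflection in (1,1,0,1) maps (a,a,a,d) to (−3(a + 2e), −3(a + 2e), a, 3e).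
      plane : ∀ d → + 9 ∣ℤ d - + 4 * a → ¬ + p ∣ℤ d → Solved p (norm ⟨ a , a , a , d ⟩) a
      plane d (divides e d≡) p∤d = from-triple (triple (a + + 2 * e) (a + + 2 * e) e
          λ (_ , _ , p∣e) → p∤d (subst (+ p ∣ℤ_) (restore d (+ 4 * a)) (∣m∣n⇒∣m+n (subst (+ p ∣ℤ_) (sym d≡) (∣m⇒∣m*n (+ 9) p∣e)) (∣n⇒∣m*n (+ 4) p∣a))))
        where
        restore : ∀ d k → d - k + k ≡ d
        restore = solve-∀
        collect : ∀ a b c d → a * a + + 3 * b * (+ 3 * b) + + 3 * c * (+ 3 * c) + + 3 * d * (+ 3 * d) ≡ a * a + + 9 * (b * b + c * c + d * d)
        collect = solve-∀
        expand : ∀ a e → a * a + + 9 * ((a + + 2 * e) * (a + + 2 * e) + (a + + 2 * e) * (a + + 2 * e) + e * e)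
          ≡ a * a + a * a + a * a + (e * + 9 + + 4 * a) * (e * + 9 + + 4 * a)
        expand = solve-∀
        d-form : e * + 9 + + 4 * a ≡ d
        d-form = trans (cong (_+ + 4 * a) (sym d≡)) (restore d (+ 4 * a))
        from-triple : Triple (a + + 2 * e) (a + + 2 * e) e → Solved p (norm ⟨ a , a , a , d ⟩) a
        from-triple (b′ , c′ , d′ , eq , ¬all , ¬all₃) = transport
          (trans (collect a b′ c′ d′) (trans (cong (λ n → a * a + + 9 * n) eq)
            (trans (expand a e) (cong (λ d → a * a + a * a + a * a + d * d) d-form))))
          (tripled b′ c′ d′ ¬all ¬all₃)

    -- The exceptional plane is a parameter because its treatment depends on a: for 3 ∣ a it
    -- contradicts `NotAll 3`, and for a ≡ 1 modulo 3 `Unit.plane` solves it.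
    module Reduced (plane : ∀ d → + 9 ∣ℤ d - + 4 * a → ¬ + p ∣ℤ d → NotAll 3 a a d → Solved p (norm ⟨ a , a , a , d ⟩) a) where

      P : ℤ → ℤ → ℤ → Set
      P b c d = NotAll p b c d → NotAll 3 b c d → Solved p (norm ⟨ a , b , c , d ⟩) a

      conclude : ∀ b c d → Outcome ⟨ a , b , c , d ⟩ → P b c d
      conclude b c d o ¬all ¬all₃ = from-outcome b c d ¬all
          (λ b≡a c≡a 9∣ → transport (cong₂ (λ b c → a * a + b * b + c * c + d * d) (sym b≡a) (sym c≡a))
            (plane d 9∣ (λ p∣d → ¬all (p∣ b≡a , p∣ c≡a , p∣d)) (λ (q , r , s) → ¬all₃ (eq∣ b≡a q , eq∣ c≡a r , s))))
          (λ b≡a d≡a 9∣ → transport (trans (norm-swap₂₃ a a c a) (cong₂ (λ b d → a * a + b * b + c * c + d * d) (sym b≡a) (sym d≡a)))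
            (plane c 9∣ (λ p∣c → ¬all (p∣ b≡a , p∣c , p∣ d≡a)) (λ (q , r , s) → ¬all₃ (eq∣ b≡a q , s , eq∣ d≡a r))))
          (λ c≡a d≡a 9∣ → transport (trans (rotate a b) (cong₂ (λ c d → a * a + b * b + c * c + d * d) (sym c≡a) (sym d≡a)))
            (plane b 9∣ (λ p∣b → ¬all (p∣b , p∣ c≡a , p∣ d≡a)) (λ (q , r , s) → ¬all₃ (s , eq∣ c≡a q , eq∣ d≡a r)))) o
        where
        p∣ : ∀ {i} → i ≡ a → + p ∣ℤ i
        p∣ eq = subst (+ p ∣ℤ_) (sym eq) p∣a
        eq∣ : ∀ {i} → i ≡ a → + 3 ∣ℤ a → + 3 ∣ℤ i
        eq∣ eq = subst (+ 3 ∣ℤ_) (sym eq)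
        rotate : ∀ a b → a * a + a * a + a * a + b * b ≡ a * a + b * b + a * a + a * a
        rotate = solve-∀

      by : ∀ b c d r → is-just (Search.start ⟨ a , b , c , d ⟩ a≢0 5 3 r [] basis) ≡ true →
           Search.Congruent ⟨ a , b , c , d ⟩ a≢0 3 r → P b c d
      by b c d r ok congruent = conclude b c d (by-search ⟨ a , b , c , d ⟩ a≢0 3 r ok congruent)

      negate : ∀ b c d → P (- b) c d → P b c d
      negate b c d s ¬all ¬all₃ = transport (norm-neg a b c d) (s (notAll-neg ¬all) (notAll-neg ¬all₃))

      swap₁₂ : ∀ b c d → P c b d → P b c d
      swap₁₂ b c d s ¬all ¬all₃ = transport (norm-swap₁₂ a b c d) (s (notAll-swap₁₂ ¬all) (notAll-swap₁₂ ¬all₃))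

      swap₂₃ : ∀ b c d → P b d c → P b c d
      swap₂₃ b c d s ¬all ¬all₃ = transport (norm-swap₂₃ a b c d) (s (notAll-swap₂₃ ¬all) (notAll-swap₂₃ ¬all₃))

      case₀₀₀ : ∀ b c d → + 3 ∣ℤ b → + 3 ∣ℤ c → + 3 ∣ℤ d → P b c d
      case₀₀₀ b c d q r s _ ¬all₃ = contradiction (q , r , s) ¬all₃

      open Normalise P negate swap₁₂ swap₂₃ case₀₀₀ public

      from-normalised : (∀ b c d → P b c d) → ∀ b c d → NotAll p b c d → Solved p (norm ⟨ a , b , c , d ⟩) a
      from-normalised f b c d ¬all = from-triple (triple b c d ¬all)
        where
        assoc : ∀ a b c d → a * a + b * b + c * c + d * d ≡ a * a + (b * b + c * c + d * d)
        assoc = solve-∀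
        from-triple : Triple b c d → Solved p (norm ⟨ a , b , c , d ⟩) a
        from-triple (b′ , c′ , d′ , eq , ¬all , ¬all₃) =
          transport (trans (assoc a b′ c′ d′) (trans (cong (λ n → a * a + n) eq) (sym (assoc a b c d)))) (f b′ c′ d′ ¬all ¬all₃)

    solved₀ : + 3 ∣ℤ a → ∀ b c d → NotAll p b c d → Solved p (norm ⟨ a , b , c , d ⟩) a
    solved₀ 3∣a = R.from-normalised (R.normalise case₁₀₀ case₁₁₀ case₁₁₁)
      where
      restore : ∀ d k → d - k + k ≡ d
      restore = solve-∀
      no-plane : ∀ d → + 9 ∣ℤ d - + 4 * a → ¬ + p ∣ℤ d → NotAll 3 a a d → Solved p (norm ⟨ a , a , a , d ⟩) a
      no-plane d 9∣ _ ¬all₃ = contradiction (3∣a , 3∣a ,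
        subst (+ 3 ∣ℤ_) (restore d (+ 4 * a)) (∣m∣n⇒∣m+n (∣-trans (divides (+ 3) refl) 9∣) (∣n⇒∣m*n (+ 4) 3∣a))) ¬all₃
      module R = Reduced no-plane
      case₁₀₀ : ∀ b c d → + 3 ∣ℤ b - 1ℤ → + 3 ∣ℤ c → + 3 ∣ℤ d → R.P b c d
      case₁₀₀ b c d q r s = R.by b c d ⟨ 0ℤ , 1ℤ , 0ℤ , 0ℤ ⟩ refl (subtract₀ a 3∣a , subtract b 1ℤ q , subtract₀ c r , subtract₀ d s)
      case₁₁₀ : ∀ b c d → + 3 ∣ℤ b - 1ℤ → + 3 ∣ℤ c - 1ℤ → + 3 ∣ℤ d → R.P b c d
      -- Splitting before any move lets the first move depend on the class modulo 9 and makes words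
      -- of denominator 9 available at once.
      case₁₁₀ b c d q r s = R.conclude b c d (by-splitting ⟨ a , b , c , d ⟩ a≢0 ⟨ 0ℤ , 1ℤ , 1ℤ , 0ℤ ⟩ refl
        (subtract₀ a 3∣a , subtract b 1ℤ q , subtract c 1ℤ r , subtract₀ d s))
      case₁₁₁ : ∀ b c d → + 3 ∣ℤ b - 1ℤ → + 3 ∣ℤ c - 1ℤ → + 3 ∣ℤ d - 1ℤ → R.P b c d
      case₁₁₁ b c d q r s = R.by b c d ⟨ 0ℤ , 1ℤ , 1ℤ , 1ℤ ⟩ refl (subtract₀ a 3∣a , subtract b 1ℤ q , subtract c 1ℤ r , subtract d 1ℤ s)

    solved₁ : + 3 ∣ℤ a - 1ℤ → ∀ b c d → NotAll p b c d → Solved p (norm ⟨ a , b , c , d ⟩) a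
    solved₁ 3∣a-1 = R.from-normalised (R.normalise case₁₀₀ case₁₁₀ case₁₁₁)
      where
      plane : ∀ d → + 9 ∣ℤ d - + 4 * a → ¬ + p ∣ℤ d → NotAll 3 a a d → Solved p (norm ⟨ a , a , a , d ⟩) a
      plane d 9∣ p∤d _ = Unit.plane 3∣a-1 d 9∣ p∤d
      module R = Reduced plane
      a₁ = subtract a 1ℤ 3∣a-1
      case₁₀₀ : ∀ b c d → + 3 ∣ℤ b - 1ℤ → + 3 ∣ℤ c → + 3 ∣ℤ d → R.P b c d
      case₁₀₀ b c d q r s = R.by b c d ⟨ 1ℤ , 1ℤ , 0ℤ , 0ℤ ⟩ refl (a₁ , subtract b 1ℤ q , subtract₀ c r , subtract₀ d s)
      case₁₁₀ : ∀ b c d → + 3 ∣ℤ b - 1ℤ → + 3 ∣ℤ c - 1ℤ → + 3 ∣ℤ d → R.P b c d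
      case₁₁₀ b c d q r s = R.by b c d ⟨ 1ℤ , 1ℤ , 1ℤ , 0ℤ ⟩ refl (a₁ , subtract b 1ℤ q , subtract c 1ℤ r , subtract₀ d s)
      case₁₁₁ : ∀ b c d → + 3 ∣ℤ b - 1ℤ → + 3 ∣ℤ c - 1ℤ → + 3 ∣ℤ d - 1ℤ → R.P b c d
      case₁₁₁ b c d q r s = R.by b c d ⟨ 1ℤ , 1ℤ , 1ℤ , 1ℤ ⟩ refl (a₁ , subtract b 1ℤ q , subtract c 1ℤ r , subtract d 1ℤ s)

  first-solved : ∀ a b c d → + p ∣ℤ a → a ≢ 0ℤ → NotAll p b c d → Solved p (norm ⟨ a , b , c , d ⟩) a
  first-solved a b c d p∣a a≢0 ¬all with residue a
  ... | is-0 3∣a    = Fixed.solved₀ a p∣a a≢0 3∣a b c d ¬all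
  ... | is-1 3∣a-1  = Fixed.solved₁ a p∣a a≢0 3∣a-1 b c d ¬all
  ... | is--1 3∣    = solved-neg a (subst (λ n → Solved p n (- a)) (lemma a b c d)
      (Fixed.solved₁ (- a) (∣m⇒∣-m p∣a) (λ eq → a≢0 (trans (sym (ℤ.neg-involutive a)) (cong -_ eq))) 3∣ b c d ¬all))
    where
    lemma : ∀ a b c d → - a * - a + b * b + c * c + d * d ≡ a * a + b * b + c * c + d * d
    lemma = solve-∀

  solved : ∀ n .{{_ : ℕ.NonZero n}} r → + p ∣ℤ r → r ≢ 0ℤ → Solved p (+ n) r
  solved n r p∣r r≢0 = from-representation (Primitive.primitiveRep pp p∤2 n)
    where
    hit : ∀ i b c d → i ≡ r ⊎ i ≡ - r → norm ⟨ i , b , c , d ⟩ ≡ + n → ¬ + p ∣ᵥ ⟨ i , b , c , d ⟩ → Solved p (+ n) r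
    hit i b c d (inj₁ refl) eq p∤ = subst (λ m → Solved p m i) eq (first-solved i b c d p∣r r≢0 (λ (s , t , u) → p∤ (p∣r , s , t , u)))
    hit i b c d (inj₂ refl) eq p∤ = solved-neg r (subst (λ m → Solved p m (- r)) eq
      (first-solved (- r) b c d (∣m⇒∣-m p∣r) (λ eq → r≢0 (trans (sym (ℤ.neg-involutive r)) (cong -_ eq))) (λ (s , t , u) → p∤ (∣m⇒∣-m p∣r , s , t , u))))

    equal? : ∀ i → (i ≡ r ⊎ i ≡ - r) ⊎ (i ≢ r × i ≢ - r)
    equal? i with i ≟ r | i ≟ - r
    ... | yes eq | _      = inj₁ (inj₁ eq)
    ... | no _   | yes eq = inj₁ (inj₂ eq)
    ... | no ≢r  | no ≢-r = inj₂ (≢r , ≢-r)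

    from-representation : Primitive.PrimitiveRep pp p∤2 n → Solved p (+ n) r
    from-representation (⟨ a , b , c , d ⟩ , eq , p∤) = cases (equal? a) (equal? b) (equal? c) (equal? d)
      where
      rotate₂ : ∀ a b c d → c * c + a * a + b * b + d * d ≡ a * a + b * b + c * c + d * d
      rotate₂ = solve-∀
      rotate₃ : ∀ a b c d → d * d + a * a + b * b + c * c ≡ a * a + b * b + c * c + d * d
      rotate₃ = solve-∀
      Either : ℤ → Set
      Either i = (i ≡ r ⊎ i ≡ - r) ⊎ (i ≢ r × i ≢ - r)
      cases : Either a → Either b → Either c → Either d → Solved p (+ n) r
      cases (inj₁ e) _ _ _ = hit a b c d e eq p∤
      cases (inj₂ _) (inj₁ e) _ _ = hit b a c d e (trans (norm-swap₀₁ a b c d) eq) (λ (q , s , t , u) → p∤ (s , q , t , u))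
      cases (inj₂ _) (inj₂ _) (inj₁ e) _ = hit c a b d e (trans (rotate₂ a b c d) eq) (λ (q , s , t , u) → p∤ (s , t , q , u))
      cases (inj₂ _) (inj₂ _) (inj₂ _) (inj₁ e) = hit d a b c e (trans (rotate₃ a b c d) eq) (λ (q , s , t , u) → p∤ (s , t , u , q))
      cases (inj₂ q) (inj₂ s) (inj₂ t) (inj₂ u) = inj₁ (⟨ a , b , c , d ⟩ , eq , q , s , t , u)

-- Assembling the theorem

prime-factor : ∀ n → n ≢ 0 → n ≢ 1 → ∃ λ q → Prime q × q ℕ.∣ n
prime-factor n n≢0 n≢1 = from-factors factors isFactorisation factorsPrime
  where
  open PrimeFactorisation (factorise n {{ℕ.≢-nonZero n≢0}})
  from-factors : ∀ fs → n ≡ product fs → All Prime fs → ∃ λ q → Prime q × q ℕ.∣ n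
  from-factors []       n≡1 _             = contradiction n≡1 n≢1
  from-factors (q ∷ qs) n≡  (pq ∷ _) = q , pq , ℕ.divides (product qs) (trans n≡ (ℕ.*-comm q (product qs)))

prime∤6 : ∀ {p} → Prime p → p ≢ 2 → p ≢ 3 → ¬ + p ∣ℤ + 6
prime∤6 {p} pp p≢2 p≢3 p∣6 = [ excluded p≢2 ∘ irreducible[2] , excluded p≢3 ∘ prime⇒irreducible (from-yes (prime? 3)) ]′
  (euclidsLemma 2 3 pp (∣⇒∣ᵤ p∣6))
  where
  excluded : ∀ {m} → p ≢ m → p ≡ 1 ⊎ p ≡ m → ⊥
  excluded p≢m (inj₁ p≡1) = ¬prime[1] (subst Prime p≡1 pp)
  excluded p≢m (inj₂ p≡m) = p≢m p≡m

abs-cases : ∀ i j → ∣ i ∣ ≡ ∣ j ∣ → i ≡ j ⊎ i ≡ - j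
abs-cases (+ m)    (+ n)    eq   = inj₁ (cong +_ eq)
abs-cases (+ _)    -[1+ _ ] eq   = inj₂ (cong +_ eq)
abs-cases -[1+ _ ] (+ _)    refl = inj₂ refl
abs-cases -[1+ _ ] -[1+ _ ] refl = inj₁ refl

same-abs : ∀ {P : ℤ → Set} i j → ∣ i ∣ ≡ ∣ j ∣ → (P (- i) → P i) → P j → P i
same-abs {P} i j eq neg pj = [ (λ i≡j → subst P (sym i≡j) pj) , (λ i≡-j →
  neg (subst P (trans (sym (ℤ.neg-involutive j)) (cong -_ (sym i≡-j))) pj)) ]′ (abs-cases i j eq)

GoodRep : ℤ → ℤ → Set
GoodRep n r = ∃ λ y → norm y ≡ n × Avoids r y

goodRep-neg : ∀ {n} r → GoodRep n (- r) → GoodRep n r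
goodRep-neg r (y , eq , av) = y , eq , avoids-neg r y av

scaled-rep : ∀ j s r y {k n} → k ≡ j * s → n ≡ k * k * + 79 → norm y ≡ s * s * + 79 → Avoids r y → j ≢ 0ℤ → GoodRep n (j * r)
scaled-rep j s r y refl refl y≡ av j≢0 = scale j y ,
  trans (norm-scale j y) (trans (cong (j * j *_) y≡) (regroup j s)) , avoids-scale j≢0 av
  where
  regroup : ∀ j s → j * j * (s * s * + 79) ≡ j * s * (j * s) * + 79
  regroup = solve-∀

module Representation {ρ : ℕ} (6≤ρ : 6 ≤ ρ) (n : ℕ) .{{_ : ℕ.NonZero n}} where

  ρ≢0 : + ρ ≢ 0ℤ
  ρ≢0 eq = ℕ.<⇒≢ (ℕ.≤-trans (s≤s z≤n) 6≤ρ) (sym (ℤ.+-injective eq))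

  -- With k = j s one has n = j² · 79 s² and ρ = |j| · 5 s, so multiplication by j transfers a
  -- representation of 79 s² that avoids 5 s.
  scaled : ∀ k s y → ρ ≡ 5 ℕ.* ∣ k ∣ → + n ≡ k * k * + 79 → + s ∣ℤ k → norm y ≡ + s * + s * + 79 → Avoids (+ s * + 5) y → GoodRep (+ n) (+ ρ)
  scaled k s y ρ≡ n≡ (divides j k≡) y≡ av = same-abs {GoodRep (+ n)} (+ ρ) (j * (+ s * + 5)) abs-eq (goodRep-neg (+ ρ))
    (scaled-rep j (+ s) (+ s * + 5) y k≡ n≡ y≡ av j≢0)
    where
    regroup : ∀ j s → j * s * + 5 ≡ j * (s * + 5)
    regroup = solve-∀
    abs-eq : ρ ≡ ∣ j * (+ s * + 5) ∣
    abs-eq = trans ρ≡ (trans (ℕ.*-comm 5 (∣ k ∣)) (trans (sym (ℤ.abs-* k (+ 5))) (cong ∣_∣ (trans (cong (_* + 5) k≡) (regroup j (+ s))))))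
    j≢0 : j ≢ 0ℤ
    j≢0 refl = ρ≢0 (cong +_ abs-eq)

  -- 79 has no representation avoiding 5, but 4 · 79 has one avoiding 10 and 9 · 79 one avoiding 15;
  -- a prime q > 3 dividing k is excluded from the second alternative of Solved q.
  exceptional-rep : ∀ k q → ρ ≡ 5 ℕ.* ∣ k ∣ → + n ≡ k * k * + 79 → Prime q → + q ∣ℤ k → Dec (q ≡ 2) → Dec (q ≡ 3) → GoodRep (+ n) (+ ρ)
  exceptional-rep k q ρ≡ n≡ pq q∣k (yes refl) _ = scaled k 2 ⟨ + 17 , + 5 , 1ℤ , 1ℤ ⟩ ρ≡ n≡ q∣k refl (from-yes (avoids? (+ 10) ⟨ + 17 , + 5 , 1ℤ , 1ℤ ⟩))
  exceptional-rep k q ρ≡ n≡ pq q∣k (no _) (yes refl) = scaled k 3 ⟨ + 26 , + 5 , + 3 , 1ℤ ⟩ ρ≡ n≡ q∣k refl (from-yes (avoids? (+ 15) ⟨ + 26 , + 5 , + 3 , 1ℤ ⟩))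
  exceptional-rep k q ρ≡ n≡ pq q∣k (no q≢2) (no q≢3) = finish (Solve.solved pq (prime∤6 pq q≢2 q≢3) n (+ ρ) q∣ρ ρ≢0)
    where
    q∣ρ : + q ∣ℤ + ρ
    q∣ρ = ∣ᵤ⇒∣ (subst (q ℕ.∣_) (sym ρ≡) (ℕ.∣n⇒∣m*n 5 (∣⇒∣ᵤ q∣k)))
    finish : Solved q (+ n) (+ ρ) → GoodRep (+ n) (+ ρ)
    finish (inj₁ rep) = rep
    finish (inj₂ (k′ , ρ≡′ , _ , q∤k′)) = contradiction
      (∣ᵤ⇒∣ (subst (q ℕ.∣_) (ℕ.*-cancelˡ-≡ (∣ k ∣) (∣ k′ ∣) 5 (trans (sym ρ≡) ρ≡′)) (∣⇒∣ᵤ q∣k))) q∤k′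

  goodRep : ∀ {p} → Prime p → p > 3 → p ℕ.∣ ρ → GoodRep (+ n) (+ ρ)
  goodRep {p} pp p>3 p∣ρ = finish (Solve.solved pp (prime∤6 pp (ℕ.<⇒≢ (ℕ.<-trans (s≤s (s≤s (s≤s z≤n))) p>3) ∘ sym) (ℕ.<⇒≢ p>3 ∘ sym)) n (+ ρ) (∣ᵤ⇒∣ p∣ρ) ρ≢0)
    where
    finish : Solved p (+ n) (+ ρ) → GoodRep (+ n) (+ ρ)
    finish (inj₁ rep) = rep
    finish (inj₂ (k , ρ≡ , n≡ , _)) = from-factor (prime-factor (∣ k ∣) (λ eq → small eq (λ ())) (λ eq → small eq λ { (s≤s (s≤s (s≤s (s≤s (s≤s ()))))) }))
      where
      small : ∀ {m} → ∣ k ∣ ≡ m → ¬ (6 ≤ 5 ℕ.* m) → ⊥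
      small eq 6≰ = 6≰ (subst (6 ≤_) (trans ρ≡ (cong (5 ℕ.*_) eq)) 6≤ρ)
      from-factor : (∃ λ q → Prime q × q ℕ.∣ ∣ k ∣) → GoodRep (+ n) (+ ρ)
      from-factor (q , pq , q∣k) = exceptional-rep k q ρ≡ n≡ pq (∣ᵤ⇒∣ q∣k) (q ℕ.≟ 2) (q ℕ.≟ 3)

  fourRep : ∀ {p} → Prime p → p > 3 → p ℕ.∣ ρ → RepBy ρ 4 n
  fourRep pp p>3 p∣ρ = from-good (goodRep pp p>3 p∣ρ)
    where
    abs≢ : ∀ i → i ≢ + ρ × i ≢ - + ρ → ∣ i ∣ ≢ ρ
    abs≢ i (≢ρ , ≢-ρ) eq = [ ≢ρ , ≢-ρ ]′ (abs-cases i (+ ρ) eq)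
    assoc : ∀ a b c d → a ℕ.+ (b ℕ.+ (c ℕ.+ (d ℕ.+ 0))) ≡ a ℕ.+ b ℕ.+ c ℕ.+ d
    assoc = ℕSolver.solve-∀
    from-good : GoodRep (+ n) (+ ρ) → RepBy ρ 4 n
    from-good (⟨ a , b , c , d ⟩ , eq , p , q , r , s) =
      ∣ a ∣ ∷ ∣ b ∣ ∷ ∣ c ∣ ∷ ∣ d ∣ ∷ [] , abs≢ a p ∷ abs≢ b q ∷ abs≢ c r ∷ abs≢ d s ∷ [] ,
      trans (assoc (∣ a ∣ ℕ.* ∣ a ∣) (∣ b ∣ ℕ.* ∣ b ∣) (∣ c ∣ ℕ.* ∣ c ∣) (∣ d ∣ ℕ.* ∣ d ∣))
        (ℤ.+-injective (trans (sym (norm≡normℕ ⟨ a , b , c , d ⟩)) eq))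

-- Deciding representability, least lengths, and the value attained at 7

SquareSum : (ℕ → Set) → ℕ → ℕ → Set
SquareSum P m n = Σ (Vec ℕ m) λ xs → VecAll.All P xs × sumSq xs ≡ n

-- A first entry x satisfies x ≤ x² ≤ n, so finitely many heads have to be tried.
squareSum? : ∀ {P} → Decidable P → ∀ m n → Dec (SquareSum P m n)
squareSum? P? zero n = map′ (λ 0≡n → [] , [] , 0≡n) (λ { ([] , [] , 0≡n) → 0≡n }) (0 ℕ.≟ n)
squareSum? {P} P? (suc m) n = map′ to from
  (ℕ.anyUpTo? (λ x → P? x ×-dec (x ℕ.* x ℕ.≤? n) ×-dec squareSum? P? m (n ℕ.∸ x ℕ.* x)) (suc n))
  where
  Head : ℕ → Set
  Head x = P x × x ℕ.* x ≤ n × SquareSum P m (n ℕ.∸ x ℕ.* x)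
  to : (∃ λ x → x ℕ.< suc n × Head x) → SquareSum P (suc m) n
  to (x , _ , px , x²≤n , xs , pxs , eq) = x ∷ xs , px ∷ pxs , trans (cong (x ℕ.* x ℕ.+_) eq) (ℕ.m+[n∸m]≡n x²≤n)
  x≤x² : ∀ x → x ≤ x ℕ.* x
  x≤x² zero    = z≤n
  x≤x² (suc x) = ℕ.m≤m*n (suc x) (suc x)
  from : SquareSum P (suc m) n → ∃ λ x → x ℕ.< suc n × Head x
  from (x ∷ xs , px ∷ pxs , eq) = x , s≤s (ℕ.≤-trans (x≤x² x) x²≤n) , px , x²≤n , xs , pxs ,
    trans (sym (ℕ.m+n∸m≡n (x ℕ.* x) (sumSq xs))) (cong (ℕ._∸ x ℕ.* x) eq)
    where
    x²≤n : x ℕ.* x ≤ n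
    x²≤n = subst (x ℕ.* x ≤_) eq (ℕ.m≤m+n (x ℕ.* x) (sumSq xs))

least-length : ∀ ρ n m → RepBy ρ (suc m) n → ∃ λ j → kIs ρ n j × j ≤ suc m
least-length ρ n m rep = search′ 1 (suc m) (s≤s z≤n) (λ { _ (s≤s z≤n) (s≤s ()) }) refl
  where
  search′ : ∀ j f → 1 ≤ j → (∀ i → 1 ≤ i → i ℕ.< j → ¬ RepBy ρ i n) → j ℕ.+ f ≡ suc (suc m) → ∃ λ j → kIs ρ n j × j ≤ suc m
  search′ j f 1≤j none eq with squareSum? (λ x → ¬? (x ℕ.≟ ρ)) j n
  -- As j + f = m + 2, fuel 0 means that all lengths up to m + 1 have been refuted, against `rep`.
  search′ j zero    1≤j none eq | yes r = contradiction rep (none (suc m) (s≤s z≤n) (ℕ.≤-reflexive (sym (trans (sym (ℕ.+-identityʳ j)) eq))))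
  search′ j (suc f) 1≤j none eq | yes r = j , (1≤j , r , none) , ℕ.≤-pred (subst (suc j ≤_) eq (subst (suc j ≤_) (sym (ℕ.+-suc j f)) (s≤s (ℕ.m≤m+n j f))))
  search′ j zero    1≤j none eq | no _ = contradiction rep (none (suc m) (s≤s z≤n) (ℕ.≤-reflexive (sym (trans (sym (ℕ.+-identityʳ j)) eq))))
  search′ j (suc f) 1≤j none eq | no ¬r = search′ (suc j) f (s≤s z≤n) none′ (trans (sym (ℕ.+-suc j f)) eq)
    where
    none′ : ∀ i → 1 ≤ i → i ℕ.< suc j → ¬ RepBy ρ i n
    none′ i 1≤i (s≤s i≤j) = [ none i 1≤i , (λ { refl → ¬r }) ]′ (ℕ.m≤n⇒m<n∨m≡n i≤j)

-- Shorter sums are refuted with the trivial predicate in place of x ≢ ρ: the decision is then a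
-- closed computation, which it would not be for a variable ρ.
seven-needs-four : ∀ ρ → 6 ≤ ρ → kIs ρ 7 4
seven-needs-four ρ 6≤ρ = s≤s z≤n ,
  (2 ∷ 1 ∷ 1 ∷ 1 ∷ [] , 2≢ρ ∷ 1≢ρ ∷ 1≢ρ ∷ 1≢ρ ∷ [] , refl) , λ
  { 1 _ _ (xs , _ , eq) → from-no (squareSum? {λ _ → ⊤} (λ _ → yes tt) 1 7) (xs , VecAll.universal (λ _ → tt) xs , eq)
  ; 2 _ _ (xs , _ , eq) → from-no (squareSum? {λ _ → ⊤} (λ _ → yes tt) 2 7) (xs , VecAll.universal (λ _ → tt) xs , eq)
  ; 3 _ _ (xs , _ , eq) → from-no (squareSum? {λ _ → ⊤} (λ _ → yes tt) 3 7) (xs , VecAll.universal (λ _ → tt) xs , eq)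
  ; (suc (suc (suc (suc _)))) _ (s≤s (s≤s (s≤s (s≤s ())))) }
  where
  2≢ρ : 2 ≢ ρ
  2≢ρ = ℕ.<⇒≢ (ℕ.≤-trans (s≤s (s≤s (s≤s z≤n))) 6≤ρ)
  1≢ρ : 1 ≢ ρ
  1≢ρ = ℕ.<⇒≢ (ℕ.≤-trans (s≤s (s≤s z≤n)) 6≤ρ)

theorem3p1 : (ρ : ℕ) → 6 ≤ ρ → (Σ ℕ λ p → Prime p × p > 3 × p ∣ ρ) → MaxIs ρ 4
theorem3p1 ρ 6≤ρ (p , pp , p>3 , p∣ρ) =
  (λ n 1≤n _ → least-length ρ n 3 (Representation.fourRep 6≤ρ n {{ℕ.>-nonZero 1≤n}} pp p>3 p∣ρ)) ,
  7 , s≤s z≤n , seven-needs-four ρ 6≤ρ
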